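{- For all integers $n\ge0$ and $c\ge1$, \begin{multline*} i_n^{(c)}=\frac{nc\left((-1)^c+1\right)}{4}r_{n-1}^{(c)}+c\left(c+1+(-1)^c\right)\binom{n}{2}r_{n-2}^{(c)}\\ +2c^2\left((-1)^c+2\right)\binom{n}{3}r_{n-3}^{(c)}+6c^3\binom{n}{4}r_{n-4}^{(c)}. \end{multline*}
   Context: Let $c\ge1$, $n\ge0$ be integers and $\Sigma_{c,n}=\{i^{[j]}:1\le i\le n,\ 0\le j<c\}$, with exponents read modulo $c$. A colored permutation is a bijection $\sigma:\Sigma_{c,n}\to\Sigma_{c,n}$ with $\sigma(i^{[j]})=(\sigma(i))^{[j]}$, where $(a^{[r]})^{[j]}=a^{[r+j\bmod c]}$ and $i=i^{[0]}$; writing $\sigma(i)=\sigma_i^{[c_i]}$ ($c_i\in\{0,\dots,c-1\}$), $\sigma$ is identified with the word $\sigma_1^{[c_1]}\cdots\sigma_n^{[c_n]}$, and $|\sigma|=\sigma_1\cdots\sigma_n$ is a permutation of $[n]$. $G_{c,n}$ is the set of colored permutations. For a permutation $\pi$, $\mathrm{inv}(\pi)=|\{(i,j):i<j,\ \pi_i>\pi_j\}|$; $\mathrm{col}(\sigma)=c_1+\cdots+c_n$; $\mathrm{inv}_c(\sigma)=\mathrm{inv}(|\sigma|)+\mathrm{col}(\sigma)+c\cdot|\{(i,j):1\le i<j\le n,\ \sigma_i<\sigma_j,\ c_j\ne0\}|$. A colored involution is $\sigma\in G_{c,n}$ with $\sigma\circ\sigma=\mathrm{id}$ on $\Sigma_{c,n}$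 (equivalently $|\sigma|$ is an involution, fixed points $i$ have $2c_i\equiv0\pmod c$, and 2-cycles $\{i,j\}$ have $c_i+c_j\equiv0\pmod c$). $r_m^{(c)}$ is the number of colored involutions in $G_{c,m}$ for $m\ge0$ ($r_0^{(c)}=1$), and $r_m^{(c)}=0$ for $m<0$. $i_n^{(c)}=\sum\mathrm{inv}_c(\sigma)$ over all colored involutions $\sigma\in G_{c,n}$. -}

module Defs where

open import Data.Nat using (ℕ; zero; suc; _+_; _*_; NonZero)
open import Data.Nat.DivMod using (_%_; m%n<n)
open import Data.Fin using (Fin; toℕ; fromℕ<; _<_)
open import Data.Fin.Properties using (all?; _<?_; _≟_)
open import Data.List using (List; []; _∷_; [_]; map; concatMap; filter; length; allFin; cartesianProduct)
open import Data.Nat.ListAction using (sum)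
open import Data.Vec using (Vec; lookup) renaming ([] to []ᵥ; _∷_ to _∷ᵥ_)
open import Data.Product using (_×_; _,_)
open import Data.Product.Properties using (≡-dec)
open import Data.Bool using (if_then_else_)
open import Data.Integer using (ℤ; +_; -[1+_])
open import Relation.Binary.PropositionalEquality using (_≡_; _≢_)
open import Relation.Nullary using (Dec; ¬_; ⌊_⌋; _×-dec_; _→-dec_; ¬?)
open import Relation.Unary using (Decidable)

allVecs : {A : Set} → List A → (n : ℕ) → List (Vec A n)
allVecs xs zero    = [ []ᵥ ]
allVecs xs (suc n) = concatMap (λ x → map (x ∷ᵥ_) (allVecs xs n)) xs

-- A candidate colored permutation σ = σ_1^[c_1] ... σ_n^[c_n] :
-- the word |σ| = σ_1 ... σ_n (entries in Fin n) and the colors c_1 ... c_n (in Fin c).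
ColWord : ℕ → ℕ → Set
ColWord n c = Vec (Fin n) n × Vec (Fin c) n

allColWords : (n c : ℕ) → List (ColWord n c)
allColWords n c = cartesianProduct (allVecs (allFin n) n) (allVecs (allFin c) n)

_+c_ : {c : ℕ} .{{_ : NonZero c}} → Fin c → Fin c → Fin c
_+c_ {c} a b = fromℕ< (m%n<n (toℕ a + toℕ b) c)

-- Σ_{c,n} = { i^[j] } represented as pairs (i , j)
Σcn : ℕ → ℕ → Set
Σcn n c = Fin n × Fin c

-- the action of σ on Σ_{c,n}: σ(i^[j]) = (σ(i))^[j] = σ_i^[c_i + j mod c]
act : {n c : ℕ} .{{_ : NonZero c}} → ColWord n c → Σcn n c → Σcn n c
act (w , col) (i , j) = lookup w i , (lookup col i +c j)

-- σ is a colored permutation: the map σ on Σ_{c,n} (equivalently |σ|) is a bijection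
-- of a finite set, i.e. injective
IsColPerm : {n c : ℕ} .{{_ : NonZero c}} → ColWord n c → Set
IsColPerm {n} {c} σ = (x y : Σcn n c) → act σ x ≡ act σ y → x ≡ y

IsColInvolution : {n c : ℕ} .{{_ : NonZero c}} → ColWord n c → Set
IsColInvolution {n} {c} σ = IsColPerm σ × ((x : Σcn n c) → act σ (act σ x) ≡ x)

Σ≟ : {n c : ℕ} (x y : Σcn n c) → Dec (x ≡ y)
Σ≟ = ≡-dec _≟_ _≟_

allΣ? : {n c : ℕ} {P : Σcn n c → Set} → ((x : Σcn n c) → Dec (P x)) → Dec ((x : Σcn n c) → P x)
allΣ? {P = P} P? = Relation.Nullary.map′ (λ h (i , j) → h i j) (λ h i j → h (i , j))
                     (all? (λ i → all? (λ j → P? (i , j))))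

isColInvolution? : {n c : ℕ} .{{_ : NonZero c}} → Decidable (IsColInvolution {n} {c})
isColInvolution? σ =
  allΣ? (λ x → allΣ? (λ y → Σ≟ (act σ x) (act σ y) →-dec Σ≟ x y))
  ×-dec allΣ? (λ x → Σ≟ (act σ (act σ x)) x)

colInvolutions : (n c : ℕ) .{{_ : NonZero c}} → List (ColWord n c)
colInvolutions n c = filter isColInvolution? (allColWords n c)

countPairs : {n : ℕ} → (P : Fin n → Fin n → Set) → (∀ i j → Dec (P i j)) → ℕ
countPairs {n} P P? =
  sum (map (λ ij → let i = Data.Product.proj₁ ij ; j = Data.Product.proj₂ ij in
              if ⌊ (i <? j) ×-dec P? i j ⌋ then 1 else 0)
           (cartesianProduct (allFin n) (allFin n)))

invW : {n : ℕ} → Vec (Fin n) n → ℕ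
invW w = countPairs (λ i j → lookup w j < lookup w i) (λ i j → lookup w j <? lookup w i)

colSum : {n c : ℕ} → Vec (Fin c) n → ℕ
colSum []ᵥ         = 0
colSum (x ∷ᵥ xs)   = toℕ x + colSum xs

invc : {n : ℕ} (c : ℕ) → ColWord n c → ℕ
invc c (w , col) =
  invW w + colSum col
  + c * countPairs (λ i j → (lookup w i < lookup w j) × (toℕ (lookup col j) ≢ 0))
                   (λ i j → (lookup w i <? lookup w j) ×-dec ¬? (toℕ (lookup col j) Data.Nat.≟ 0))

iNum : (n c : ℕ) .{{_ : NonZero c}} → ℕ
iNum n c = sum (map (invc c) (colInvolutions n c))

rNat : (m c : ℕ) .{{_ : NonZero c}} → ℕ
rNat m c = length (colInvolutions m c)

r : (m : ℤ) (c : ℕ) .{{_ : NonZero c}} → ℕ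
r (+ m)      c = rNat m c
r -[1+ _ ]   c = 0

{-# OPTIONS --safe #-}
-- Remove the letter 1 from a colored involution. Either 1 is fixed, with a self-inverse color, or it lies
-- in a 2-cycle with some k, whose two colors are inverse to each other; what remains is an arbitrary colored
-- involution on n-1 or n-2 letters. In both cases the change of inv_c only involves k, the colors removed,
-- and the positions of the nonzero colors of the rest. The number of colored involutions with a nonzero color
-- at position j does not depend on j, so summing gives a two-step recursion for i_n. The numbers
-- P_k(n) = C(n,k) r_{n-k} satisfy n P_k(n-1) = (k+1) P_{k+1}(n) and
-- P_{k+1}(n+1) = P_k(n) + f P_{k+1}(n) + c (k+2) P_{k+2}(n), where f is the number of self-inverse colors,
-- and with these identities the claimed combination of P_1, ..., P_4 satisfies the same recursion.
module Submission where

open import Defs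
open import Data.Nat using (ℕ; zero; suc; NonZero)
open import Data.Nat.Combinatorics using (_C_)
open import Data.Nat.Tactic.RingSolver using (solve-∀)
open import Data.Fin using (Fin; zero; suc; toℕ; fromℕ<; punchIn)
open import Data.Fin.Properties using (toℕ-injective; toℕ-fromℕ<)
open import Data.List using (List; []; _∷_; [_]; length)
open import Data.List.Relation.Binary.Permutation.Propositional using (_↭_)
import Data.List.Relation.Binary.Permutation.Propositional.Properties as ↭ₚ
open import Data.Product using (_×_; _,_; proj₁; proj₂; ∃; uncurry)
open import Data.Sum using (_⊎_; inj₁; inj₂)
open import Function using (_∘_; id; _⇔_; mk⇔; Equivalence)
open import Relation.Binary.PropositionalEquality using (_≡_; refl; sym; trans; cong; cong₂; subst; module ≡-Reasoning)
open import Relation.Nullary using (Dec; yes; no; does; _×-dec_; ¬?; contradiction)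
open import Relation.Nullary.Decidable using (isYes≗does)

-- The parity of c stays out of the induction. Only three numbers attached to the self-inverse
-- colors enter: their number `f`, the number `g` of nonzero ones and their sum `h`. The induction
-- treats them as independent variables; the sign and the denominator 4 come in at the end, through
-- f = g + 1, fg = 2g, cg = 2h and (-1)^c + 1 = 2g. The coefficients of the closed form are forced.
-- Once every term of the recursion for i_(N+1) is written with P_k(N), comparing the coefficients
-- of P_0, P_1, P_2, P_3 yields h, c(c + fg), 2c^2(f + g), 6c^3 in turn, and those of P_4 and P_5
-- then agree. A count at a single position suffices because removing the cycle leaves the
-- comparisons among the other letters intact, and a pair lost with it involves at most one of them.
-- Such a pair may compare the value w(j) instead of the position j, but the color at w(j) is
-- inverse to the color at j, so both are zero or both are not; a sum over values therefore becomes
-- a sum over positions.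

module Counting where
  open import Data.Bool using (Bool; true; false; _∧_; not; if_then_else_)
  open import Data.Bool.Properties using (∧-zeroʳ; ∧-identityʳ)
  open import Data.Empty using (⊥)
  open import Data.Fin using (punchOut; opposite; fromℕ<)
  open import Data.Fin.Permutation using (permutation)
  open import Data.Fin.Properties using (_≟_; _<?_; toℕ<n; punchIn-punchOut; punchInᵢ≢i; punchIn-injective; suc-injective; opposite-prop; opposite-involutive)
  open import Data.List using (map; concatMap; filter; allFin; cartesianProduct; cartesianProductWith; tabulate; _++_)
  open import Data.List.Membership.Propositional using (_∈_)
  open import Data.List.Membership.Propositional.Properties
  open import Data.List.Membership.Propositional.Properties.WithK using (unique∧set⇒bag)
  open import Data.List.Properties using (map-∘; map-++; map-tabulate)
  open import Data.List.Relation.Binary.BagAndSetEquality using (∼bag⇒↭)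
  open import Data.List.Relation.Unary.All using ([]; _∷_)
  open import Data.List.Relation.Unary.AllPairs using ([]; _∷_)
  open import Data.List.Relation.Unary.Any using (here; there)
  open import Data.List.Relation.Unary.Unique.Propositional using (Unique)
  import Data.List.Relation.Unary.Unique.Propositional.Properties as Uniqueₚ
  open import Data.Nat using (_+_; _*_; _∸_; _<ᵇ_; _≡ᵇ_)
  open import Data.Nat.Combinatorics using (nCk+nC[k+1]≡[n+1]C[k+1]; nC1≡n; k>n⇒nCk≡0)
  open import Data.Nat.DivMod using (_%_; m%n<n; %-distribˡ-+; m%n%n≡m%n; m<n⇒m%n≡m; n%n≡0)
  open import Data.Nat.ListAction using (sum)
  open import Data.Nat.ListAction.Properties using (sum-++; sum-↭)
  open import Data.Nat.Properties hiding (_≟_; _<?_; suc-injective)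
  open import Algebra.Properties.Semiring.Sum +-*-semiring
    using (sum-cong-≗; ∑-distrib-+; ∑-comm; sum-remove; ∑-permute; *-distribˡ-sum; *-distribʳ-sum) renaming (sum to ∑)
  open import Data.Vec using (Vec; lookup; insertAt; removeAt) renaming ([] to []ᵥ; _∷_ to _∷ᵥ_; map to mapᵥ)
  open import Data.Vec.Properties using (∷-injective; removeAt-insertAt; insertAt-removeAt; insertAt-lookup; insertAt-punchIn; lookup-map)

  -- Enumerations without repetition, and deletion and relabelling in vectors.

  allVecs≡ : ∀ {A : Set} (xs : List A) n → allVecs xs (suc n) ≡ cartesianProductWith _∷ᵥ_ xs (allVecs xs n)
  allVecs≡ {A} xs n = go xs
    where
    go : ∀ zs → concatMap (λ x → map (x ∷ᵥ_) (allVecs xs n)) zs ≡ cartesianProductWith _∷ᵥ_ zs (allVecs xs n)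
    go []       = refl
    go (z ∷ zs) = cong (map (z ∷ᵥ_) (allVecs xs n) ++_) (go zs)

  allVecs-complete : ∀ {A : Set} {xs : List A} → (∀ x → x ∈ xs) → ∀ {n} (v : Vec A n) → v ∈ allVecs xs n
  allVecs-complete all []ᵥ = here refl
  allVecs-complete {xs = xs} all {suc n} (x ∷ᵥ v) =
    subst (x ∷ᵥ v ∈_) (sym (allVecs≡ xs n)) (∈-cartesianProductWith⁺ _∷ᵥ_ (all x) (allVecs-complete all v))

  allVecs-unique : ∀ {A : Set} {xs : List A} → Unique xs → ∀ n → Unique (allVecs xs n)
  allVecs-unique u zero = [] ∷ []
  allVecs-unique {xs = xs} u (suc n) =
    subst Unique (sym (allVecs≡ xs n)) (Uniqueₚ.cartesianProductWith⁺ _∷ᵥ_ ∷-injective u (allVecs-unique u n))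

  -- Without repetitions each member occurs exactly once, so equal sets are equal bags. Sums and
  -- lengths depend on a list only up to `↭`, so the filtered enumeration can be traded for a
  -- constructed one.
  unique-set⇒↭ : ∀ {A : Set} {xs ys : List A} → Unique xs → Unique ys → (∀ {x} → x ∈ xs ⇔ x ∈ ys) → xs ↭ ys
  unique-set⇒↭ u v eq = ∼bag⇒↭ (unique∧set⇒bag u v eq)

  punchIn-surj : ∀ {n} (k i : Fin (suc n)) → i ≡ k ⊎ ∃ λ j → i ≡ punchIn k j
  punchIn-surj k i with k ≟ i
  ... | yes k≡i = inj₁ (sym k≡i)
  ... | no  k≢i = inj₂ (punchOut k≢i , sym (punchIn-punchOut k≢i))

  lookup-removeAt : ∀ {A : Set} {n} (v : Vec A (suc n)) k j → lookup (removeAt v k) j ≡ lookup v (punchIn k j)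
  lookup-removeAt v k j = begin
    lookup (removeAt v k) j                                        ≡⟨ insertAt-punchIn (removeAt v k) k (lookup v k) j ⟨
    lookup (insertAt (removeAt v k) k (lookup v k)) (punchIn k j)  ≡⟨ cong (λ u → lookup u (punchIn k j)) (insertAt-removeAt v k) ⟩
    lookup v (punchIn k j)                                         ∎
    where open ≡-Reasoning

  insertAt-injective : ∀ {A : Set} {n} {u v : Vec A n} k {x} → insertAt u k x ≡ insertAt v k x → u ≡ v
  insertAt-injective {u = u} {v} k {x} e =
    trans (sym (removeAt-insertAt u k x)) (trans (cong (λ t → removeAt t k) e) (removeAt-insertAt v k x))

  map-surj : ∀ {A B : Set} {f : A → B} {n} (v : Vec B n) → (∀ j → ∃ λ x → lookup v j ≡ f x) → ∃ λ u → v ≡ mapᵥ f u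
  map-surj []ᵥ       h = []ᵥ , refl
  map-surj (y ∷ᵥ v) h with h zero | map-surj v (h ∘ suc)
  ... | x , refl | u , refl = x ∷ᵥ u , refl

  map-inj : ∀ {A B : Set} {f : A → B} → (∀ {x y} → f x ≡ f y → x ≡ y) → ∀ {n} {u v : Vec A n} → mapᵥ f u ≡ mapᵥ f v → u ≡ v
  map-inj inj {u = []ᵥ}     {[]ᵥ}     eq = refl
  map-inj inj {u = _ ∷ᵥ _} {_ ∷ᵥ _} eq with ∷-injective eq
  ... | p , q = cong₂ _∷ᵥ_ (inj p) (map-inj inj q)

  -- Finite sums over lists and over `Fin`.

  Σₗ : ∀ {A : Set} → List A → (A → ℕ) → ℕ
  Σₗ xs F = sum (map F xs)

  Σₗ-cong : ∀ {A : Set} {xs : List A} {F G : A → ℕ} → (∀ {x} → x ∈ xs → F x ≡ G x) → Σₗ xs F ≡ Σₗ xs G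
  Σₗ-cong {xs = []}     eq = refl
  Σₗ-cong {xs = x ∷ xs} eq = cong₂ _+_ (eq (here refl)) (Σₗ-cong {xs = xs} (eq ∘ there))

  Σₗ-+ : ∀ {A : Set} (xs : List A) (F G : A → ℕ) → Σₗ xs (λ x → F x + G x) ≡ Σₗ xs F + Σₗ xs G
  Σₗ-+ []       F G = refl
  Σₗ-+ (x ∷ xs) F G = trans (cong (F x + G x +_) (Σₗ-+ xs F G)) (lem (F x) (G x) (Σₗ xs F) (Σₗ xs G))
    where
    lem : ∀ a b c d → a + b + (c + d) ≡ a + c + (b + d)
    lem = solve-∀

  Σₗ-*ˡ : ∀ {A : Set} (xs : List A) k (F : A → ℕ) → Σₗ xs (λ x → k * F x) ≡ k * Σₗ xs F
  Σₗ-*ˡ []       k F = sym (*-zeroʳ k)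
  Σₗ-*ˡ (x ∷ xs) k F = trans (cong (k * F x +_) (Σₗ-*ˡ xs k F)) (sym (*-distribˡ-+ k (F x) _))

  Σₗ-const : ∀ {A : Set} (xs : List A) k → Σₗ xs (λ _ → k) ≡ length xs * k
  Σₗ-const []       k = refl
  Σₗ-const (x ∷ xs) k = cong (k +_) (Σₗ-const xs k)

  Σₗ-map : ∀ {A B : Set} (f : A → B) xs (F : B → ℕ) → Σₗ (map f xs) F ≡ Σₗ xs (F ∘ f)
  Σₗ-map f xs F = cong sum (sym (map-∘ xs))

  Σₗ-++ : ∀ {A : Set} (xs ys : List A) F → Σₗ (xs ++ ys) F ≡ Σₗ xs F + Σₗ ys F
  Σₗ-++ xs ys F = trans (cong sum (map-++ F xs ys)) (sum-++ (map F xs) (map F ys))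

  Σₗ-× : ∀ {A B : Set} (xs : List A) (ys : List B) F →
         Σₗ (cartesianProduct xs ys) F ≡ Σₗ xs (λ x → Σₗ ys (λ y → F (x , y)))
  Σₗ-× []       ys F = refl
  Σₗ-× (x ∷ xs) ys F = trans (Σₗ-++ (map (x ,_) ys) (cartesianProduct xs ys) F)
    (cong₂ _+_ (Σₗ-map (x ,_) ys F) (Σₗ-× xs ys F))

  Σₗ-↭ : ∀ {A : Set} {xs ys : List A} F → xs ↭ ys → Σₗ xs F ≡ Σₗ ys F
  Σₗ-↭ F p = sum-↭ (↭ₚ.map⁺ F p)

  Σₗ-allFin : ∀ {n} (F : Fin n → ℕ) → Σₗ (allFin n) F ≡ ∑ F
  Σₗ-allFin F = trans (cong sum (map-tabulate id F)) (go F)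
    where
    go : ∀ {n} (F : Fin n → ℕ) → sum (tabulate F) ≡ ∑ F
    go {zero}  F = refl
    go {suc n} F = cong (F zero +_) (go (F ∘ suc))

  Σₗ-∑ : ∀ {A : Set} {n} (xs : List A) (F : A → Fin n → ℕ) → Σₗ xs (λ x → ∑ (F x)) ≡ ∑ λ j → Σₗ xs (λ x → F x j)
  Σₗ-∑ {n = zero}  xs F = trans (Σₗ-const xs 0) (*-zeroʳ (length xs))
  Σₗ-∑ {n = suc n} xs F = trans (Σₗ-+ xs (λ x → F x zero) _) (cong (Σₗ xs (λ x → F x zero) +_) (Σₗ-∑ xs (λ x → F x ∘ suc)))

  ∑-const : ∀ n k → ∑ {n} (λ _ → k) ≡ n * k
  ∑-const zero    k = refl
  ∑-const (suc n) k = cong (k +_) (∑-const n k)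

  ∑-zero : ∀ {n} {F : Fin n → ℕ} → (∀ i → F i ≡ 0) → ∑ F ≡ 0
  ∑-zero {n} eq = trans (sum-cong-≗ eq) (trans (∑-const n 0) (*-zeroʳ n))

  -- Indicators and the counts they produce.

  𝟙 : Bool → ℕ
  𝟙 b = if b then 1 else 0

  𝟙-∧ : ∀ a b → 𝟙 (a ∧ b) ≡ 𝟙 a * 𝟙 b
  𝟙-∧ false b = refl
  𝟙-∧ true  b = sym (*-identityˡ (𝟙 b))

  -- Boolean valued, so that comparisons with `zero` and between successors reduce by computation;
  -- many terms of the double sums below vanish definitionally for this reason.
  infix 7 _<ᶠ_
  _<ᶠ_ : ∀ {m n} → Fin m → Fin n → Bool
  i <ᶠ j = toℕ i <ᵇ toℕ j

  <ᶠ-irrefl : ∀ {n} (i : Fin n) → (i <ᶠ i) ≡ false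
  <ᶠ-irrefl zero    = refl
  <ᶠ-irrefl (suc i) = <ᶠ-irrefl i

  punchIn-<ᶠ : ∀ {n} (k : Fin (suc n)) i j → (punchIn k i <ᶠ punchIn k j) ≡ (i <ᶠ j)
  punchIn-<ᶠ zero    i       j       = refl
  punchIn-<ᶠ (suc k) zero    zero    = refl
  punchIn-<ᶠ (suc k) zero    (suc j) = refl
  punchIn-<ᶠ (suc k) (suc i) zero    = refl
  punchIn-<ᶠ (suc k) (suc i) (suc j) = punchIn-<ᶠ k i j

  -- `punchIn k` runs through all values except `k`, in increasing order.
  below-count : ∀ {n} (k : Fin (suc n)) → ∑ (λ j → 𝟙 (punchIn k j <ᶠ k)) ≡ toℕ k
  below-count {n}     zero    = ∑-zero {n} (λ _ → refl)
  below-count {suc n} (suc k) = cong suc (below-count k)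

  -- The comparison holds exactly for `k ≤ j`: then `punchIn k j` is `j + 1`, and otherwise it is
  -- `j`.
  above-count : ∀ {n} (j : Fin n) → ∑ (λ k → 𝟙 (k <ᶠ punchIn k j)) ≡ suc (toℕ j)
  above-count {suc n} zero    = cong suc (∑-zero {suc n} (λ _ → refl))
  above-count {suc n} (suc j) = cong suc (above-count j)

  triangular : ∀ n → 2 * ∑ {n} (λ j → suc (toℕ j)) ≡ n * suc n
  triangular zero    = refl
  triangular (suc n) = begin
    2 * (1 + ∑ {n} (λ j → 1 + suc (toℕ j)))      ≡⟨ cong (λ s → 2 * (1 + s)) (∑-distrib-+ {n} (λ _ → 1) (λ j → suc (toℕ j))) ⟩
    2 * (1 + (∑ {n} (λ _ → 1) + ∑ {n} (λ j → suc (toℕ j)))) ≡⟨ cong (λ s → 2 * (1 + (s + ∑ {n} (λ j → suc (toℕ j))))) (∑-const n 1) ⟩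
    2 * (1 + (n * 1 + ∑ {n} (λ j → suc (toℕ j)))) ≡⟨ lem₁ n _ ⟩
    2 + 2 * n + 2 * ∑ {n} (λ j → suc (toℕ j)) ≡⟨ cong (2 + 2 * n +_) (triangular n) ⟩
    2 + 2 * n + n * suc n ≡⟨ lem₂ n ⟩
    suc n * suc (suc n) ∎
    where
    open ≡-Reasoning
    lem₁ : ∀ n s → 2 * (1 + (n * 1 + s)) ≡ 2 + 2 * n + 2 * s
    lem₁ = solve-∀
    lem₂ : ∀ n → 2 + 2 * n + n * suc n ≡ suc n * suc (suc n)
    lem₂ = solve-∀

  odd-sum : ∀ n → ∑ {n} (λ k → 1 + 2 * toℕ k) ≡ n * n
  odd-sum zero    = refl
  odd-sum (suc n) = begin
    1 + ∑ {n} (λ k → 1 + 2 * suc (toℕ k)) ≡⟨ cong suc (sum-cong-≗ {n} (λ k → lem₁ (toℕ k))) ⟩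
    1 + ∑ {n} (λ k → 2 + (1 + 2 * toℕ k)) ≡⟨ cong suc (∑-distrib-+ {n} (λ _ → 2) _) ⟩
    1 + (∑ {n} (λ _ → 2) + ∑ {n} (λ k → 1 + 2 * toℕ k)) ≡⟨ cong suc (cong₂ _+_ (∑-const n 2) (odd-sum n)) ⟩
    1 + (n * 2 + n * n) ≡⟨ lem₂ n ⟩
    suc n * suc n ∎
    where
    open ≡-Reasoning
    lem₁ : ∀ k → 1 + 2 * suc k ≡ 2 + (1 + 2 * k)
    lem₁ = solve-∀
    lem₂ : ∀ n → 1 + (n * 2 + n * n) ≡ suc n * suc n
    lem₂ = solve-∀

  -- The statistic inv_c as a double sum of indicators.

  colored : ∀ {c} → Fin c → Bool
  colored a = not (toℕ a ≡ᵇ 0)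

  inversions : ∀ {n} → (Fin n → Fin n) → ℕ
  inversions w = ∑ λ i → ∑ λ j → 𝟙 (i <ᶠ j ∧ w j <ᶠ w i)

  coloredAscents : ∀ {n c} → (Fin n → Fin n) → (Fin n → Fin c) → ℕ
  coloredAscents w κ = ∑ λ i → ∑ λ j → 𝟙 (i <ᶠ j ∧ (w i <ᶠ w j ∧ colored (κ j)))

  statistic : ∀ {n c} → (Fin n → Fin n) → (Fin n → Fin c) → ℕ
  statistic {c = c} w κ = inversions w + ∑ (toℕ ∘ κ) + c * coloredAscents w κ

  countPairs≡ : ∀ {n} (P : Fin n → Fin n → Set) (P? : ∀ i j → Dec (P i j)) →
                countPairs P P? ≡ ∑ λ i → ∑ λ j → 𝟙 (i <ᶠ j ∧ does (P? i j))
  countPairs≡ {n} P P? = trans (Σₗ-× (allFin n) (allFin n) _)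
    (trans (Σₗ-allFin {n} _) (sum-cong-≗ λ i → trans (Σₗ-allFin {n} _) (sum-cong-≗ λ j →
      cong 𝟙 (isYes≗does ((i <? j) ×-dec P? i j)))))

  invc≡statistic : ∀ {n c} (w : Vec (Fin n) n) (κ : Vec (Fin c) n) → invc c (w , κ) ≡ statistic (lookup w) (lookup κ)
  invc≡statistic {c = c} w κ = cong₂ _+_
    (cong₂ _+_ (countPairs≡ _ (λ i j → lookup w j <? lookup w i)) (colSum≡ κ))
    (cong (c *_) (countPairs≡ _ (λ i j → (lookup w i <? lookup w j) ×-dec ¬? (toℕ (lookup κ j) Data.Nat.≟ 0))))
    where
    colSum≡ : ∀ {n} (κ : Vec (Fin c) n) → colSum κ ≡ ∑ (toℕ ∘ lookup κ)
    colSum≡ []ᵥ       = refl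
    colSum≡ (a ∷ᵥ κ) = cong (toℕ a +_) (colSum≡ κ)

  ∑-split : ∀ {n} (k : Fin (suc n)) (F : Fin (suc (suc n)) → ℕ) →
            ∑ F ≡ F zero + (F (suc k) + ∑ (λ j → F (suc (punchIn k j))))
  ∑-split k F = cong (F zero +_) (sum-remove {i = k} (F ∘ suc))

  -- Absorption identities for binomial coefficients.

  C-absorb : ∀ n k → suc k * (suc n C suc k) ≡ suc n * (n C k)
  C-absorb zero    zero    = refl
  C-absorb zero    (suc k) = *-zeroʳ (2 + k)
  C-absorb (suc n) zero    = begin
    1 * (suc (suc n) C 1)   ≡⟨ *-identityˡ _ ⟩
    suc (suc n) C 1         ≡⟨ nC1≡n (suc (suc n)) ⟩
    suc (suc n)             ≡⟨ *-identityʳ _ ⟨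
    suc (suc n) * 1         ∎
    where open ≡-Reasoning
  C-absorb (suc n) (suc k) = begin
    (2 + k) * ((2 + n) C (2 + k))               ≡⟨ cong ((2 + k) *_) (nCk+nC[k+1]≡[n+1]C[k+1] (suc n) (suc k)) ⟨
    (2 + k) * (x + (suc n C (2 + k)))           ≡⟨ lem₁ k x _ ⟩
    x + (suc k * x + (2 + k) * (suc n C (2 + k))) ≡⟨ cong (x +_) (cong₂ _+_ (C-absorb n k) (C-absorb n (suc k))) ⟩
    x + (suc n * (n C k) + suc n * (n C suc k)) ≡⟨ cong (x +_) (*-distribˡ-+ (suc n) (n C k) _) ⟨
    x + suc n * ((n C k) + (n C suc k))         ≡⟨ cong (λ y → x + suc n * y) (nCk+nC[k+1]≡[n+1]C[k+1] n k) ⟩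
    (2 + n) * x                                 ∎
    where
    open ≡-Reasoning
    x : ℕ
    x = suc n C suc k
    lem₁ : ∀ k x y → (2 + k) * (x + y) ≡ x + (suc k * x + (2 + k) * y)
    lem₁ = solve-∀

  -- The identity (k+1) C(n,k+1) = (n-k) C(n,k), with n = k + d in place of a truncated subtraction.
  -- Pascal's rule and absorption evaluate (k+1) C(n+1,k+1) in two ways.
  C-absorb-+ : ∀ d k → suc k * ((k + d) C suc k) ≡ d * ((k + d) C k)
  C-absorb-+ d k = +-cancelˡ-≡ (suc k * ((k + d) C k)) _ _ (begin
    suc k * ((k + d) C k) + suc k * ((k + d) C suc k) ≡⟨ *-distribˡ-+ (suc k) ((k + d) C k) _ ⟨
    suc k * ((k + d) C k + (k + d) C suc k)           ≡⟨ cong (suc k *_) (nCk+nC[k+1]≡[n+1]C[k+1] (k + d) k) ⟩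
    suc k * (suc (k + d) C suc k)                     ≡⟨ C-absorb (k + d) k ⟩
    suc (k + d) * ((k + d) C k)                       ≡⟨ lem k d _ ⟩
    suc k * ((k + d) C k) + d * ((k + d) C k)         ∎)
    where
    open ≡-Reasoning
    lem : ∀ k d x → suc (k + d) * x ≡ suc k * x + d * x
    lem = solve-∀

  Σₗ-1 : ∀ {A : Set} (xs : List A) → Σₗ xs (λ _ → 1) ≡ length xs
  Σₗ-1 xs = trans (Σₗ-const xs 1) (*-identityʳ (length xs))

  2*n≡n+n : ∀ n → 2 * n ≡ n + n
  2*n≡n+n n = cong (n +_) (+-identityʳ n)

  -- Arithmetic of colors modulo c = m + 1.

  module Coloured (m : ℕ) where

    private
      c : ℕ
      c = suc m

    -- The inverse color, given by cases rather than by a remainder: a nonzero color then visibly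
    -- has a nonzero inverse, and the two add up to exactly `c`.
    neg : Fin c → Fin c
    neg zero    = zero
    neg (suc i) = suc (opposite i)

    neg-involutive : ∀ a → neg (neg a) ≡ a
    neg-involutive zero    = refl
    neg-involutive (suc i) = cong suc (opposite-involutive i)

    toℕ-neg-suc : ∀ i → toℕ (suc i) + toℕ (neg (suc i)) ≡ c
    toℕ-neg-suc i = begin
      suc (toℕ i) + suc (toℕ (opposite i))  ≡⟨ +-suc (suc (toℕ i)) _ ⟩
      suc (suc (toℕ i) + toℕ (opposite i))  ≡⟨ cong (λ x → suc (suc (toℕ i) + x)) (opposite-prop i) ⟩
      suc (suc (toℕ i) + (m ∸ suc (toℕ i))) ≡⟨ cong suc (m+[n∸m]≡n (toℕ<n i)) ⟩
      c                                     ∎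
      where open ≡-Reasoning

    +neg-% : ∀ a → (toℕ a + toℕ (neg a)) % c ≡ 0
    +neg-% zero    = refl
    +neg-% (suc i) = trans (cong (_% c) (toℕ-neg-suc i)) (n%n≡0 c)

    +-cancel-% : ∀ (a : ℕ) (x y : Fin c) → (a + toℕ x) % c ≡ (a + toℕ y) % c → x ≡ y
    +-cancel-% a x y eq = toℕ-injective (begin
      toℕ x                                 ≡⟨ lem x ⟨
      (toℕ (neg a%c) + (a + toℕ x) % c) % c ≡⟨ cong (λ z → (toℕ (neg a%c) + z) % c) eq ⟩
      (toℕ (neg a%c) + (a + toℕ y) % c) % c ≡⟨ lem y ⟩
      toℕ y                                 ∎)
      where
      open ≡-Reasoning
      a%c : Fin c
      a%c = fromℕ< (m%n<n a c)
      absorb : ∀ p q → (p + q % c) % c ≡ (p + q) % c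
      absorb p q = begin
        (p + q % c) % c             ≡⟨ %-distribˡ-+ p (q % c) c ⟩
        (p % c + q % c % c) % c     ≡⟨ cong (λ z → (p % c + z) % c) (m%n%n≡m%n q c) ⟩
        (p % c + q % c) % c         ≡⟨ %-distribˡ-+ p q c ⟨
        (p + q) % c                 ∎
      lem : ∀ z → (toℕ (neg a%c) + (a + toℕ z) % c) % c ≡ toℕ z
      lem z = begin
        (toℕ (neg a%c) + (a + toℕ z) % c) % c  ≡⟨ absorb (toℕ (neg a%c)) (a + toℕ z) ⟩
        (toℕ (neg a%c) + (a + toℕ z)) % c      ≡⟨ cong (_% c) (trans (sym (+-assoc (toℕ (neg a%c)) a (toℕ z))) (+-comm _ (toℕ z))) ⟩
        (toℕ z + (toℕ (neg a%c) + a)) % c      ≡⟨ absorb (toℕ z) _ ⟨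
        (toℕ z + (toℕ (neg a%c) + a) % c) % c  ≡⟨ cong (λ w → (toℕ z + w) % c) (absorb (toℕ (neg a%c)) a) ⟨
        (toℕ z + (toℕ (neg a%c) + a % c) % c) % c ≡⟨ cong (λ w → (toℕ z + (toℕ (neg a%c) + w) % c) % c) (toℕ-fromℕ< (m%n<n a c)) ⟨
        (toℕ z + (toℕ (neg a%c) + toℕ a%c) % c) % c ≡⟨ cong (λ w → (toℕ z + w % c) % c) (+-comm (toℕ (neg a%c)) (toℕ a%c)) ⟩
        (toℕ z + (toℕ a%c + toℕ (neg a%c)) % c) % c ≡⟨ cong (λ w → (toℕ z + w) % c) (+neg-% a%c) ⟩
        (toℕ z + 0) % c                        ≡⟨ cong (_% c) (+-identityʳ (toℕ z)) ⟩
        toℕ z % c                              ≡⟨ m<n⇒m%n≡m (toℕ<n z) ⟩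
        toℕ z                                  ∎

    toℕ-+c : ∀ (a b : Fin c) → toℕ (a +c b) ≡ (toℕ a + toℕ b) % c
    toℕ-+c a b = toℕ-fromℕ< _

    +c-assoc : ∀ x y z → toℕ (x +c (y +c z)) ≡ (toℕ x + toℕ y + toℕ z) % c
    +c-assoc x y z = begin
      toℕ (x +c (y +c z))                      ≡⟨ toℕ-+c x (y +c z) ⟩
      (toℕ x + toℕ (y +c z)) % c               ≡⟨ cong (λ w → (toℕ x + w) % c) (toℕ-+c y z) ⟩
      (toℕ x + (toℕ y + toℕ z) % c) % c        ≡⟨ %-distribˡ-+ (toℕ x) _ c ⟩
      (toℕ x % c + (toℕ y + toℕ z) % c % c) % c ≡⟨ cong (λ w → (toℕ x % c + w) % c) (m%n%n≡m%n (toℕ y + toℕ z) c) ⟩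
      (toℕ x % c + (toℕ y + toℕ z) % c) % c    ≡⟨ %-distribˡ-+ (toℕ x) _ c ⟨
      (toℕ x + (toℕ y + toℕ z)) % c            ≡⟨ cong (_% c) (+-assoc (toℕ x) _ _) ⟨
      (toℕ x + toℕ y + toℕ z) % c              ∎
      where open ≡-Reasoning

    +c-neg-cancel : ∀ a b → neg a +c (a +c b) ≡ b
    +c-neg-cancel a b = toℕ-injective (begin
      toℕ (neg a +c (a +c b))                       ≡⟨ +c-assoc (neg a) a b ⟩
      (toℕ (neg a) + toℕ a + toℕ b) % c             ≡⟨ %-distribˡ-+ (toℕ (neg a) + toℕ a) (toℕ b) c ⟩
      ((toℕ (neg a) + toℕ a) % c + toℕ b % c) % c   ≡⟨ cong (λ w → (w % c + toℕ b % c) % c) (+-comm (toℕ (neg a)) (toℕ a)) ⟩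
      ((toℕ a + toℕ (neg a)) % c + toℕ b % c) % c   ≡⟨ cong (λ w → (w + toℕ b % c) % c) (+neg-% a) ⟩
      toℕ b % c % c                                 ≡⟨ m%n%n≡m%n (toℕ b) c ⟩
      toℕ b % c                                     ≡⟨ m<n⇒m%n≡m (toℕ<n b) ⟩
      toℕ b                                         ∎)
      where open ≡-Reasoning

    -- The hypothesis is the color component of the equation saying that the square of the map fixes
    -- an element with exponent 0.
    neg-unique : ∀ a b → b +c (a +c zero) ≡ zero → b ≡ neg a
    neg-unique a b eq = +-cancel-% (toℕ a) b (neg a) (begin
      (toℕ a + toℕ b) % c       ≡⟨ cong (_% c) (trans (+-comm (toℕ a) (toℕ b)) (sym (+-identityʳ _))) ⟩
      (toℕ b + toℕ a + 0) % c   ≡⟨ +c-assoc b a zero ⟨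
      toℕ (b +c (a +c zero))    ≡⟨ cong toℕ eq ⟩
      0                         ≡⟨ +neg-% a ⟨
      (toℕ a + toℕ (neg a)) % c ∎)
      where open ≡-Reasoning

    -- Colored involutions described position by position.

    IsInv : ∀ {n} → ColWord n c → Set
    IsInv (w , κ) = ∀ i → lookup w (lookup w i) ≡ i × lookup κ (lookup w i) ≡ neg (lookup κ i)

    -- One direction evaluates the square at the elements with exponent 0. Conversely, a map whose
    -- square is the identity is injective: apply it to both sides of an equality of images.
    IsColInvolution⇔IsInv : ∀ {n} (σ : ColWord n c) → IsColInvolution σ ⇔ IsInv σ
    IsColInvolution⇔IsInv (w , κ) = mk⇔
      (λ (_ , h) i → cong proj₁ (h (i , zero)) , neg-unique _ _ (cong proj₂ (h (i , zero))))
      (λ h → let s = sq h in (λ x y eq → trans (sym (s x)) (trans (cong (act (w , κ)) eq) (s y))) , s)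
      where
      sq : IsInv (w , κ) → ∀ x → act (w , κ) (act (w , κ) x) ≡ x
      sq h (i , j) = cong₂ _,_ (proj₁ (h i)) (trans (cong (_+c (lookup κ i +c j)) (proj₂ (h i))) (+c-neg-cancel (lookup κ i) j))

    -- Opaque, so that type checking does not unfold the filtered list of all words. Outside this
    -- block the list is known by its members, by having no repetitions and by `involutions≡`.
    opaque
      involutions : ∀ n → List (ColWord n c)
      involutions n = colInvolutions n c

      involutions≡ : ∀ n .{{nz : NonZero c}} → involutions n ≡ colInvolutions n c {{nz}}
      involutions≡ n = refl

      ∈-involutions : ∀ {n} {σ : ColWord n c} → σ ∈ involutions n ⇔ IsInv σ
      ∈-involutions {n} {σ} = mk⇔
        (λ σ∈ → Equivalence.to (IsColInvolution⇔IsInv σ)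
          (proj₂ (∈-filter⁻ (isColInvolution? {n} {c}) {v = σ} {xs = allColWords n c} σ∈)))
        (λ h → ∈-filter⁺ (isColInvolution? {n} {c}) {x = σ} {xs = allColWords n c}
          (∈-cartesianProduct⁺ {x = proj₁ σ} {y = proj₂ σ} {xs = allVecs (allFin n) n} {ys = allVecs (allFin c) n}
            (allVecs-complete ∈-allFin (proj₁ σ)) (allVecs-complete ∈-allFin (proj₂ σ)))
          (Equivalence.from (IsColInvolution⇔IsInv σ) h))

      involutions-unique : ∀ n → Unique (involutions n)
      involutions-unique n = Uniqueₚ.filter⁺ isColInvolution?
        (Uniqueₚ.cartesianProduct⁺ (allVecs-unique (Uniqueₚ.allFin⁺ n) n) (allVecs-unique (Uniqueₚ.allFin⁺ c) n))

    -- Inserting a fixed point or a 2-cycle at the front.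

    addFixed : ∀ {n} → Fin c → ColWord n c → ColWord (suc n) c
    addFixed a (w , κ) = zero ∷ᵥ mapᵥ suc w , a ∷ᵥ κ

    -- The new cycle joins the positions `zero` and `suc k`. The map `suc ∘ punchIn k` places the
    -- old letters, both as positions and as values, and preserves their order.
    addCycle : ∀ {n} → Fin (suc n) → Fin c → ColWord n c → ColWord (suc (suc n)) c
    addCycle k a (w , κ) = suc k ∷ᵥ insertAt (mapᵥ (suc ∘ punchIn k) w) k zero , a ∷ᵥ insertAt κ k (neg a)

    module _ {n} (k : Fin (suc n)) (a : Fin c) (τ : ColWord n c) where
      private
        w  = proj₁ τ
        κ  = proj₂ τ
        w⁺ = proj₁ (addCycle k a τ)
        κ⁺ = proj₂ (addCycle k a τ)

      addCycle-word-partner : lookup w⁺ (suc k) ≡ zero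
      addCycle-word-partner = insertAt-lookup (mapᵥ (suc ∘ punchIn k) w) k zero

      addCycle-word-old : ∀ j → lookup w⁺ (suc (punchIn k j)) ≡ suc (punchIn k (lookup w j))
      addCycle-word-old j = trans (insertAt-punchIn (mapᵥ (suc ∘ punchIn k) w) k zero j) (lookup-map j _ w)

      addCycle-col-partner : lookup κ⁺ (suc k) ≡ neg a
      addCycle-col-partner = insertAt-lookup κ k (neg a)

      addCycle-col-old : ∀ j → lookup κ⁺ (suc (punchIn k j)) ≡ lookup κ j
      addCycle-col-old j = insertAt-punchIn κ k (neg a) j

      IsInv-addCycle : IsInv (addCycle k a τ) ⇔ IsInv τ
      IsInv-addCycle = mk⇔ to from
        where
        to : IsInv (addCycle k a τ) → IsInv τ
        to h j =
          punchIn-injective k _ _ (suc-injective (trans (sym (addCycle-word-old _))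
            (trans (cong (lookup w⁺) (sym (addCycle-word-old j))) (proj₁ (h (suc (punchIn k j))))))) ,
          trans (sym (addCycle-col-old _)) (trans (cong (lookup κ⁺) (sym (addCycle-word-old j)))
            (trans (proj₂ (h (suc (punchIn k j)))) (cong neg (addCycle-col-old j))))
        from : IsInv τ → IsInv (addCycle k a τ)
        from h zero = addCycle-word-partner , addCycle-col-partner
        from h (suc i) with punchIn-surj k i
        ... | inj₁ refl = cong (lookup w⁺) addCycle-word-partner ,
          trans (cong (lookup κ⁺) addCycle-word-partner) (trans (sym (neg-involutive a)) (cong neg (sym addCycle-col-partner)))
        ... | inj₂ (j , refl) =
          trans (cong (lookup w⁺) (addCycle-word-old j)) (trans (addCycle-word-old _) (cong (suc ∘ punchIn k) (proj₁ (h j)))) ,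
          trans (cong (lookup κ⁺) (addCycle-word-old j)) (trans (addCycle-col-old _)
            (trans (proj₂ (h j)) (cong neg (sym (addCycle-col-old j)))))

    IsInv-addFixed : ∀ {n} a (τ : ColWord n c) → IsInv (addFixed a τ) ⇔ (neg a ≡ a × IsInv τ)
    IsInv-addFixed a (w , κ) = mk⇔ to from
      where
      w⁺ = zero ∷ᵥ mapᵥ suc w
      to : IsInv (addFixed a (w , κ)) → neg a ≡ a × IsInv (w , κ)
      to h = sym (proj₂ (h zero)) , λ j →
        suc-injective (trans (sym (lookup-map _ suc w)) (trans (cong (lookup w⁺) (sym (lookup-map j suc w))) (proj₁ (h (suc j))))) ,
        trans (cong (lookup (a ∷ᵥ κ)) (sym (lookup-map j suc w))) (proj₂ (h (suc j)))
      from : neg a ≡ a × IsInv (w , κ) → IsInv (addFixed a (w , κ))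
      from (eq , h) zero = refl , sym eq
      from (eq , h) (suc j) =
        trans (cong (lookup w⁺) (lookup-map j suc w)) (trans (lookup-map _ suc w) (cong suc (proj₁ (h j)))) ,
        trans (cong (lookup (a ∷ᵥ κ)) (lookup-map j suc w)) (proj₂ (h j))

    addFixed-injective : ∀ {n a b} {τ υ : ColWord n c} → addFixed a τ ≡ addFixed b υ → a ≡ b × τ ≡ υ
    addFixed-injective eq with ∷-injective (cong proj₁ eq) | ∷-injective (cong proj₂ eq)
    ... | _ , p | q , r = q , cong₂ _,_ (map-inj suc-injective p) r

    addCycle-injective : ∀ {n k l a b} {τ υ : ColWord n c} → addCycle k a τ ≡ addCycle l b υ → k ≡ l × a ≡ b × τ ≡ υ
    addCycle-injective {k = k} {a = a} {τ = w , κ} {υ = w′ , κ′} eq with ∷-injective (cong proj₁ eq) | ∷-injective (cong proj₂ eq)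
    ... | refl , p | refl , q = refl , refl , cong₂ _,_
      (map-inj (punchIn-injective k _ _ ∘ suc-injective) (insertAt-injective k p)) (insertAt-injective k q)

    -- The first letter tells the two cases apart; being an involution keeps the other values away
    -- from the removed letters, so `map-surj` can undo the relabelling. The equation `e` and the
    -- `subst` are there because `addCycle` only yields words of length at least two, while `n` is
    -- arbitrary.
    decompose : ∀ {n} (σ : ColWord (suc n) c) → IsInv σ →
      (∃ λ a → ∃ λ τ → σ ≡ addFixed a τ) ⊎
      (∃ λ n′ → ∃ λ k → ∃ λ a → ∃ λ τ → ∃ λ (e : n ≡ suc n′) → subst (λ n → ColWord (suc n) c) e σ ≡ addCycle k a τ)
    decompose (zero ∷ᵥ w , a ∷ᵥ κ) h with map-surj {f = suc} w nonzero
      where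
      nonzero : ∀ j → ∃ λ l → lookup w j ≡ suc l
      nonzero j with lookup w j in e
      ... | suc l = l , refl
      ... | zero with () ← trans (sym (cong (lookup (zero ∷ᵥ w)) e)) (proj₁ (h (suc j)))
    ... | u , refl = inj₁ (a , (u , κ) , refl)
    decompose {suc n} (suc k ∷ᵥ w , a ∷ᵥ κ) h with map-surj {f = suc ∘ punchIn k} (removeAt w k) avoid
      where
      avoid : ∀ j → ∃ λ l → lookup (removeAt w k) j ≡ suc (punchIn k l)
      avoid j with lookup w (punchIn k j) in e
      -- If an old position had value `zero`, then `zero` would be sent back to it, but `zero` is
      -- sent to `suc k`.
      ... | zero with () ← punchInᵢ≢i k j (suc-injective (trans (sym (proj₁ (h (suc (punchIn k j))))) (cong (lookup (suc k ∷ᵥ w)) e)))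
      ... | suc i with punchIn-surj k i
      ...   | inj₂ (l , refl) = l , trans (lookup-removeAt w k j) e
      -- If an old position had value `suc k`, then `suc k` would be sent back to it, but `suc k` is
      -- sent to `zero`.
      ...   | inj₁ refl with () ← trans (sym (proj₁ (h (suc (punchIn k j))))) (trans (cong (lookup (suc k ∷ᵥ w)) e) (proj₁ (h zero)))
    ... | u , e = inj₂ (n , k , a , (u , removeAt κ k) , refl ,
      cong₂ _,_
        (cong (suc k ∷ᵥ_) (trans (sym (insertAt-removeAt w k)) (cong₂ (λ v x → insertAt v k x) e (proj₁ (h zero)))))
        (cong (a ∷ᵥ_) (trans (sym (insertAt-removeAt κ k)) (cong (insertAt (removeAt κ k) k) (proj₂ (h zero))))))

    -- The enumeration of colored involutions split by the first letter.

    selfInverse : List (Fin c)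
    selfInverse = filter (λ a → neg a ≟ a) (allFin c)

    withCycle : ∀ n → List (ColWord (suc n) c)
    withCycle zero    = []
    withCycle (suc n) = map (λ (k , a , τ) → addCycle k a τ)
      (cartesianProduct (allFin (suc n)) (cartesianProduct (allFin c) (involutions n)))

    withFixed : ∀ n → List (ColWord (suc n) c)
    withFixed n = map (uncurry addFixed) (cartesianProduct selfInverse (involutions n))

    withFixed-unique : ∀ n → Unique (withFixed n)
    withFixed-unique n = Uniqueₚ.map⁺ (λ e → let p , q = addFixed-injective e in cong₂ _,_ p q)
      (Uniqueₚ.cartesianProduct⁺ (Uniqueₚ.filter⁺ (λ a → neg a ≟ a) (Uniqueₚ.allFin⁺ c)) (involutions-unique n))

    withCycle-unique : ∀ n → Unique (withCycle n)
    withCycle-unique zero    = []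
    withCycle-unique (suc n) = Uniqueₚ.map⁺ (λ e → let p , q , r = addCycle-injective e in cong₂ _,_ p (cong₂ _,_ q r))
      (Uniqueₚ.cartesianProduct⁺ (Uniqueₚ.allFin⁺ (suc n)) (Uniqueₚ.cartesianProduct⁺ (Uniqueₚ.allFin⁺ c) (involutions-unique n)))

    -- Both insertions are injective, their images differ in the first letter, and `decompose` shows
    -- that they exhaust the involutions.
    involutions-suc : ∀ n → involutions (suc n) ↭ withFixed n ++ withCycle n
    involutions-suc n = unique-set⇒↭ (involutions-unique (suc n))
      (Uniqueₚ.++⁺ (withFixed-unique n) (withCycle-unique n) (disjoint n)) (mk⇔ (to n _) (from n))
      where
      open Equivalence using () renaming (to to fwd; from to bwd)
      disjoint : ∀ n {σ} → (σ ∈ withFixed n × σ ∈ withCycle n) → ⊥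
      disjoint (suc n) (p , q) with ∈-map⁻ (uncurry addFixed) p | ∈-map⁻ _ q
      ... | _ , _ , refl | _ , _ , ()
      to : ∀ n σ → σ ∈ involutions (suc n) → σ ∈ withFixed n ++ withCycle n
      to n σ σ∈ with decompose σ (fwd ∈-involutions σ∈)
      ... | inj₁ (a , τ , refl) with fwd (IsInv-addFixed a τ) (fwd ∈-involutions σ∈)
      ...   | eq , h = ∈-++⁺ˡ (∈-map⁺ _ (∈-cartesianProduct⁺ (∈-filter⁺ (λ a → neg a ≟ a) (∈-allFin a) eq) (bwd ∈-involutions h)))
      to n σ σ∈ | inj₂ (n′ , k , a , τ , refl , refl) =
        ∈-++⁺ʳ (withFixed n) (∈-map⁺ _ (∈-cartesianProduct⁺ (∈-allFin k)
          (∈-cartesianProduct⁺ (∈-allFin a) (bwd ∈-involutions (fwd (IsInv-addCycle k a τ) (fwd ∈-involutions σ∈))))))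
      from : ∀ n {σ} → σ ∈ withFixed n ++ withCycle n → σ ∈ involutions (suc n)
      from n σ∈ with ∈-++⁻ (withFixed n) σ∈
      ... | inj₁ p with ∈-map⁻ (uncurry addFixed) p
      ...   | (a , τ) , q , refl with ∈-cartesianProduct⁻ selfInverse (involutions n) q
      ...     | a∈ , τ∈ = bwd ∈-involutions (bwd (IsInv-addFixed a τ)
                  (proj₂ (∈-filter⁻ (λ a → neg a ≟ a) {xs = allFin c} a∈) , fwd ∈-involutions τ∈))
      from (suc n) σ∈ | inj₂ p with ∈-map⁻ _ p
      ... | (k , a , τ) , q , refl = bwd ∈-involutions (bwd (IsInv-addCycle k a τ)
        (fwd ∈-involutions (proj₂ (∈-cartesianProduct⁻ (allFin c) (involutions n) (proj₂ (∈-cartesianProduct⁻ (allFin (suc n)) _ q))))))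

    -- The change of inv_c under the two insertions.

    -- The new first letter is the smallest: it makes no inversion, and it makes an ascent with
    -- every later position, of weight `c` when that position is colored.
    invc-addFixed : ∀ {n} a (τ : ColWord n c) →
      invc c (addFixed a τ) ≡ toℕ a + invc c τ + c * ∑ (λ j → 𝟙 (colored (lookup (proj₂ τ) j)))
    invc-addFixed {n} a (w , κ) = begin
      invc c (addFixed a (w , κ))                         ≡⟨ invc≡statistic (zero ∷ᵥ mapᵥ suc w) (a ∷ᵥ κ) ⟩
      inversions w⁺ + (toℕ a + ∑ (toℕ ∘ lookup κ)) + c * coloredAscents w⁺ (lookup (a ∷ᵥ κ))
        ≡⟨ cong₂ (λ x y → x + (toℕ a + ∑ (toℕ ∘ lookup κ)) + c * y) inv-eq asc-eq ⟩
      inversions (lookup w) + (toℕ a + ∑ (toℕ ∘ lookup κ)) + c * (N + coloredAscents (lookup w) (lookup κ))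
        ≡⟨ lem (inversions (lookup w)) (toℕ a) (∑ (toℕ ∘ lookup κ)) c N (coloredAscents (lookup w) (lookup κ)) ⟩
      toℕ a + statistic (lookup w) (lookup κ) + c * N     ≡⟨ cong (λ x → toℕ a + x + c * N) (invc≡statistic w κ) ⟨
      toℕ a + invc c (w , κ) + c * N                      ∎
      where
      open ≡-Reasoning
      w⁺ : Fin (suc n) → Fin (suc n)
      w⁺ = lookup (zero ∷ᵥ mapᵥ suc w)
      N : ℕ
      N = ∑ (λ j → 𝟙 (colored (lookup κ j)))
      w⁺-suc : ∀ i → w⁺ (suc i) ≡ suc (lookup w i)
      w⁺-suc i = lookup-map i suc w
      inv-eq : inversions w⁺ ≡ inversions (lookup w)
      inv-eq = cong₂ _+_ (∑-zero {n} λ j → cong (λ x → 𝟙 (x <ᶠ zero {n})) (w⁺-suc j))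
        (sum-cong-≗ λ i → sum-cong-≗ λ j → cong₂ (λ x y → 𝟙 (i <ᶠ j ∧ x <ᶠ y)) (w⁺-suc j) (w⁺-suc i))
      asc-eq : coloredAscents w⁺ (lookup (a ∷ᵥ κ)) ≡ N + coloredAscents (lookup w) (lookup κ)
      asc-eq = cong₂ _+_ (sum-cong-≗ λ j → cong (λ x → 𝟙 (zero {n} <ᶠ x ∧ colored (lookup κ j))) (w⁺-suc j))
        (sum-cong-≗ λ i → sum-cong-≗ λ j →
          cong₂ (λ x y → 𝟙 (i <ᶠ j ∧ (x <ᶠ y ∧ colored (lookup κ j)))) (w⁺-suc i) (w⁺-suc j))
      lem : ∀ i a s c n x → i + (a + s) + c * (n + x) ≡ a + (i + s + c * x) + c * n
      lem = solve-∀

    colored-neg : ∀ (a : Fin c) → colored (neg a) ≡ colored a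
    colored-neg zero    = refl
    colored-neg (suc a) = refl

    module _ {n} {τ : ColWord n c} (τ-inv : IsInv τ) where
      private
        w = lookup (proj₁ τ)
        κ = lookup (proj₂ τ)

      -- The word of an involution permutes the positions, so a sum over its values is a sum over
      -- positions.
      reindex : ∀ F → ∑ (F ∘ w) ≡ ∑ F
      reindex F = sym (∑-permute F (permutation w w (proj₁ ∘ τ-inv) (proj₁ ∘ τ-inv)))

      module _ (k : Fin (suc n)) (a : Fin c) where
        private
          w⁺ = lookup (proj₁ (addCycle k a τ))
          κ⁺ = lookup (proj₂ (addCycle k a τ))
          p : Fin n → Fin (suc (suc n))
          p = suc ∘ punchIn k
          w⁺k : w⁺ (suc k) ≡ zero
          w⁺k = addCycle-word-partner k a τ
          w⁺p : ∀ j → w⁺ (p j) ≡ p (w j)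
          w⁺p = addCycle-word-old k a τ
          κ⁺k : κ⁺ (suc k) ≡ neg a
          κ⁺k = addCycle-col-partner k a τ
          κ⁺p : ∀ j → κ⁺ (p j) ≡ κ j
          κ⁺p = addCycle-col-old k a τ
          𝟙-falseʳ : ∀ b {x} → x ≡ false → 𝟙 (b ∧ x) ≡ 0
          𝟙-falseʳ b refl = cong 𝟙 (∧-zeroʳ b)

        -- The `1` is the pair formed by the new cycle. Position `zero` carries `suc k`, which
        -- exceeds `k` of the old values; position `suc k` carries the least value, which is
        -- exceeded at the `k` old positions in front of it.
        inversions-addCycle : inversions w⁺ ≡ 1 + 2 * toℕ k + inversions w
        inversions-addCycle = begin
          inversions w⁺
            ≡⟨ ∑-split k (λ i → ∑ (G i)) ⟩
          ∑ (G zero) + (∑ (G (suc k)) + ∑ (λ i → ∑ (G (p i))))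
            ≡⟨ cong₂ _+_ row₀ (cong₂ _+_ rowₖ (trans (sum-cong-≗ rowₚ) (∑-distrib-+ {n} (λ i → 𝟙 (punchIn k i <ᶠ k)) _))) ⟩
          1 + ∑ (λ j → 𝟙 (punchIn k (w j) <ᶠ k)) + (0 + (∑ (λ i → 𝟙 (punchIn k i <ᶠ k)) + inversions w))
            ≡⟨ cong (λ x → 1 + x + (0 + (∑ (λ i → 𝟙 (punchIn k i <ᶠ k)) + inversions w))) (reindex (λ j → 𝟙 (punchIn k j <ᶠ k))) ⟩
          1 + ∑ (λ j → 𝟙 (punchIn k j <ᶠ k)) + (0 + (∑ (λ i → 𝟙 (punchIn k i <ᶠ k)) + inversions w))
            ≡⟨ cong (λ x → 1 + x + (0 + (x + inversions w))) (below-count k) ⟩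
          1 + toℕ k + (0 + (toℕ k + inversions w))
            ≡⟨ lem (toℕ k) (inversions w) ⟩
          1 + 2 * toℕ k + inversions w ∎
          where
          open ≡-Reasoning
          G : Fin (suc (suc n)) → Fin (suc (suc n)) → ℕ
          G i j = 𝟙 (i <ᶠ j ∧ w⁺ j <ᶠ w⁺ i)
          row₀ : ∑ (G zero) ≡ 1 + ∑ (λ j → 𝟙 (punchIn k (w j) <ᶠ k))
          row₀ = trans (∑-split k (G zero)) (cong₂ _+_ (cong (λ x → 𝟙 (x <ᶠ suc k)) w⁺k)
            (sum-cong-≗ λ j → cong (λ x → 𝟙 (x <ᶠ suc k)) (w⁺p j)))
          rowₖ : ∑ (G (suc k)) ≡ 0
          rowₖ = ∑-zero λ j → 𝟙-falseʳ (suc k <ᶠ j) (cong (λ x → w⁺ j <ᶠ x) w⁺k)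
          rowₚ : ∀ i → ∑ (G (p i)) ≡ 𝟙 (punchIn k i <ᶠ k) + ∑ (λ j → 𝟙 (i <ᶠ j ∧ w j <ᶠ w i))
          rowₚ i = trans (∑-split k (G (p i))) (cong₂ _+_
            (cong 𝟙 (trans (cong₂ (λ x y → p i <ᶠ suc k ∧ x <ᶠ y) w⁺k (w⁺p i)) (∧-identityʳ _)))
            (sum-cong-≗ λ j → cong 𝟙 (cong₂ _∧_ (punchIn-<ᶠ k i j)
              (trans (cong₂ _<ᶠ_ (w⁺p j) (w⁺p i)) (punchIn-<ᶠ k (w j) (w i))))))
          lem : ∀ k i → 1 + k + (0 + (k + i)) ≡ 1 + 2 * k + i
          lem = solve-∀

        -- Position `zero` makes ascents with the larger old values, position `suc k` with the old
        -- positions behind it. By `reindex` and `colored-neg` the two weighted counts agree, hence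
        -- the factor 2. The new colors themselves weight no ascent: nothing precedes position
        -- `zero`, and position `suc k` carries the least value.
        coloredAscents-addCycle : coloredAscents w⁺ κ⁺ ≡
          2 * ∑ (λ j → 𝟙 (k <ᶠ punchIn k j) * 𝟙 (colored (κ j))) + coloredAscents w κ
        coloredAscents-addCycle = begin
          coloredAscents w⁺ κ⁺
            ≡⟨ ∑-split k (λ i → ∑ (H i)) ⟩
          ∑ (H zero) + (∑ (H (suc k)) + ∑ (λ i → ∑ (H (p i))))
            ≡⟨ cong₂ _+_ (trans row₀ (reindex A)) (cong₂ _+_ rowₖ (sum-cong-≗ rowₚ)) ⟩
          ∑ A + (∑ A + coloredAscents w κ)
            ≡⟨ lem (∑ A) (coloredAscents w κ) ⟩
          2 * ∑ A + coloredAscents w κ ∎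
          where
          open ≡-Reasoning
          H : Fin (suc (suc n)) → Fin (suc (suc n)) → ℕ
          H i j = 𝟙 (i <ᶠ j ∧ (w⁺ i <ᶠ w⁺ j ∧ colored (κ⁺ j)))
          A : Fin n → ℕ
          A j = 𝟙 (k <ᶠ punchIn k j) * 𝟙 (colored (κ j))
          row₀ : ∑ (H zero) ≡ ∑ (A ∘ w)
          row₀ = trans (∑-split k (H zero)) (cong₂ _+_
            (cong (λ x → 𝟙 (suc k <ᶠ x ∧ colored (κ⁺ (suc k)))) w⁺k)
            (sum-cong-≗ λ j → trans (cong₂ (λ x y → 𝟙 (suc k <ᶠ x ∧ colored y)) (w⁺p j) (κ⁺p j))
              (trans (𝟙-∧ (k <ᶠ punchIn k (w j)) _) (cong (λ b → 𝟙 (k <ᶠ punchIn k (w j)) * 𝟙 b)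
                (sym (trans (cong colored (proj₂ (τ-inv j))) (colored-neg (κ j))))))))
          rowₖ : ∑ (H (suc k)) ≡ ∑ A
          rowₖ = trans (∑-split k (H (suc k))) (cong₂ _+_
            (cong (λ b → 𝟙 (b ∧ (w⁺ (suc k) <ᶠ w⁺ (suc k) ∧ colored (κ⁺ (suc k))))) (<ᶠ-irrefl (suc k)))
            (sum-cong-≗ λ j → trans (cong 𝟙 (cong₂ (λ b y → suc k <ᶠ p j ∧ (b ∧ colored y)) (cong₂ _<ᶠ_ w⁺k (w⁺p j)) (κ⁺p j)))
              (𝟙-∧ (k <ᶠ punchIn k j) _)))
          rowₚ : ∀ i → ∑ (H (p i)) ≡ ∑ (λ j → 𝟙 (i <ᶠ j ∧ (w i <ᶠ w j ∧ colored (κ j))))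
          rowₚ i = trans (∑-split k (H (p i))) (cong₂ _+_
            (𝟙-falseʳ (p i <ᶠ suc k) (cong₂ (λ x y → x <ᶠ y ∧ colored (κ⁺ (suc k))) (w⁺p i) w⁺k))
            (sum-cong-≗ λ j → cong 𝟙 (cong₂ _∧_ (punchIn-<ᶠ k i j)
              (cong₂ _∧_ (trans (cong₂ _<ᶠ_ (w⁺p i) (w⁺p j)) (punchIn-<ᶠ k (w i) (w j))) (cong colored (κ⁺p j))))))
          lem : ∀ a x → a + (a + x) ≡ 2 * a + x
          lem = solve-∀

        invc-addCycle : invc c (addCycle k a τ) ≡
          1 + 2 * toℕ k + (toℕ a + toℕ (neg a)) + invc c τ + c * (2 * ∑ (λ j → 𝟙 (k <ᶠ punchIn k j) * 𝟙 (colored (κ j))))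
        invc-addCycle = begin
          invc c (addCycle k a τ)
            ≡⟨ invc≡statistic (proj₁ (addCycle k a τ)) (proj₂ (addCycle k a τ)) ⟩
          inversions w⁺ + ∑ (toℕ ∘ κ⁺) + c * coloredAscents w⁺ κ⁺
            ≡⟨ cong₂ _+_ (cong₂ _+_ inversions-addCycle (trans (∑-split k (toℕ ∘ κ⁺))
                 (cong (toℕ a +_) (cong₂ _+_ (cong toℕ κ⁺k) (sum-cong-≗ (cong toℕ ∘ κ⁺p))))))
                 (cong (c *_) coloredAscents-addCycle) ⟩
          1 + 2 * toℕ k + inversions w + (toℕ a + (toℕ (neg a) + ∑ (toℕ ∘ κ))) + c * (2 * S + coloredAscents w κ)
            ≡⟨ lem (toℕ k) (inversions w) (toℕ a) (toℕ (neg a)) (∑ (toℕ ∘ κ)) c S (coloredAscents w κ) ⟩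
          1 + 2 * toℕ k + (toℕ a + toℕ (neg a)) + statistic w κ + c * (2 * S)
            ≡⟨ cong (λ x → 1 + 2 * toℕ k + (toℕ a + toℕ (neg a)) + x + c * (2 * S)) (invc≡statistic (proj₁ τ) (proj₂ τ)) ⟨
          1 + 2 * toℕ k + (toℕ a + toℕ (neg a)) + invc c τ + c * (2 * S) ∎
          where
          open ≡-Reasoning
          S : ℕ
          S = ∑ (λ j → 𝟙 (k <ᶠ punchIn k j) * 𝟙 (colored (κ j)))
          lem : ∀ k i a b s c t x → 1 + 2 * k + i + (a + (b + s)) + c * (2 * t + x) ≡ 1 + 2 * k + (a + b) + (i + s + c * x) + c * (2 * t)
          lem = solve-∀

    -- Sums over involutions along the decomposition.

    Σ-involutions-suc : ∀ n (F : ColWord (suc n) c → ℕ) → Σₗ (involutions (suc n)) F ≡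
      Σₗ selfInverse (λ a → Σₗ (involutions n) (F ∘ addFixed a)) + Σₗ (withCycle n) F
    Σ-involutions-suc n F = trans (Σₗ-↭ F (involutions-suc n)) (trans (Σₗ-++ (withFixed n) (withCycle n) F)
      (cong (_+ Σₗ (withCycle n) F) (trans (Σₗ-map (uncurry addFixed) (cartesianProduct selfInverse (involutions n)) F)
        (Σₗ-× selfInverse (involutions n) (F ∘ uncurry addFixed)))))

    Σ-withCycle : ∀ n (F : ColWord (suc (suc n)) c → ℕ) → Σₗ (withCycle (suc n)) F ≡
      ∑ {suc n} λ k → ∑ λ a → Σₗ (involutions n) (F ∘ addCycle k a)
    Σ-withCycle n F = trans (Σₗ-map cycle (cartesianProduct (allFin (suc n)) pairs) F)
      (trans (Σₗ-× (allFin (suc n)) pairs (F ∘ cycle)) (trans (Σₗ-allFin {suc n} (λ k → Σₗ pairs (λ p → F (cycle (k , p)))))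
        (sum-cong-≗ {suc n} λ k → trans (Σₗ-× (allFin c) (involutions n) (λ p → F (cycle (k , p))))
          (Σₗ-allFin {c} (λ a → Σₗ (involutions n) (F ∘ addCycle k a))))))
      where
      pairs : List (Fin c × ColWord n c)
      pairs = cartesianProduct (allFin c) (involutions n)
      cycle : Fin (suc n) × Fin c × ColWord n c → ColWord (suc (suc n)) c
      cycle (k , a , τ) = addCycle k a τ

    -- f is (3 + (-1)^c) / 2, g is f - 1 and h is g c / 2.
    f g h : ℕ
    f = length selfInverse
    g = Σₗ selfInverse (𝟙 ∘ colored)
    h = Σₗ selfInverse toℕ

    ∑-colored : ∑ (𝟙 ∘ colored {c}) ≡ m
    ∑-colored = trans (∑-const m 1) (*-identityʳ m)

    -- The color zero contributes 0, and each of the `m` others contributes `c`.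
    ∑-color+neg : ∑ (λ (a : Fin c) → toℕ a + toℕ (neg a)) ≡ m * c
    ∑-color+neg = trans (sum-cong-≗ {m} toℕ-neg-suc) (∑-const m c)

    -- ρ n k is r_{n-k}.
    ρ : ℕ → ℕ → ℕ
    ρ n       zero    = length (involutions n)
    ρ zero    (suc k) = 0
    ρ (suc n) (suc k) = ρ n k

    -- The recursion for the number of colored involutions.

    length-withCycle : ∀ n → length (withCycle n) ≡ c * (n * ρ n 1)
    length-withCycle zero    = sym (*-zeroʳ c)
    length-withCycle (suc n) = begin
      length (withCycle (suc n))                      ≡⟨ Σₗ-1 (withCycle (suc n)) ⟨
      Σₗ (withCycle (suc n)) (λ _ → 1)                ≡⟨ Σ-withCycle n (λ _ → 1) ⟩
      ∑ {suc n} (λ _ → ∑ {c} λ _ → Σₗ (involutions n) (λ _ → 1)) ≡⟨ ∑-const (suc n) _ ⟩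
      suc n * ∑ {c} (λ _ → Σₗ (involutions n) (λ _ → 1)) ≡⟨ cong (suc n *_) (∑-const c _) ⟩
      suc n * (c * Σₗ (involutions n) (λ _ → 1))      ≡⟨ cong (λ x → suc n * (c * x)) (Σₗ-1 (involutions n)) ⟩
      suc n * (c * ρ n 0)                             ≡⟨ lem n c (ρ n 0) ⟩
      c * (suc n * ρ n 0)                             ∎
      where
      open ≡-Reasoning
      lem : ∀ n c x → suc n * (c * x) ≡ c * (suc n * x)
      lem = solve-∀

    ρ-suc : ∀ n → ρ (suc n) 0 ≡ f * ρ n 0 + c * (n * ρ n 1)
    ρ-suc n = begin
      length (involutions (suc n))                    ≡⟨ Σₗ-1 (involutions (suc n)) ⟨
      Σₗ (involutions (suc n)) (λ _ → 1)              ≡⟨ Σ-involutions-suc n (λ _ → 1) ⟩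
      Σₗ selfInverse (λ _ → Σₗ (involutions n) (λ _ → 1)) + Σₗ (withCycle n) (λ _ → 1)
        ≡⟨ cong₂ _+_ (trans (Σₗ-const selfInverse (Σₗ (involutions n) (λ _ → 1))) (cong (f *_) (Σₗ-1 (involutions n))))
                     (trans (Σₗ-1 (withCycle n)) (length-withCycle n)) ⟩
      f * ρ n 0 + c * (n * ρ n 1)                     ∎
      where open ≡-Reasoning

    -- The numbers C(n,k) r_(n-k).

    P : ℕ → ℕ → ℕ
    P k n = (n C k) * ρ n k

    -- Absorption of the binomial; `ρ n k` and `ρ (suc n) (suc k)` are the same by definition. This
    -- moves a term from argument n to argument n + 1.
    P-pred : ∀ k n → suc n * P k n ≡ suc k * P (suc k) (suc n)
    P-pred k n = begin
      suc n * ((n C k) * ρ n k)             ≡⟨ *-assoc (suc n) (n C k) _ ⟨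
      suc n * (n C k) * ρ n k               ≡⟨ cong (_* ρ n k) (C-absorb n k) ⟨
      suc k * (suc n C suc k) * ρ n k       ≡⟨ *-assoc (suc k) (suc n C suc k) _ ⟩
      suc k * P (suc k) (suc n)             ∎
      where open ≡-Reasoning

    ρ-+ : ∀ k d j → ρ (k + d) (k + j) ≡ ρ d j
    ρ-+ zero    d j = refl
    ρ-+ (suc k) d j = ρ-+ k d j

    -- The recursion `ρ-suc` at n - k, multiplied by a binomial that absorbs its factor n - k.
    C-ρ-suc : ∀ k n → (n C k) * ρ (suc n) k ≡ f * P k n + c * (suc k * P (suc k) n)
    C-ρ-suc k n with ≤-<-connex k n
    -- For k = n + 1 the unweighted recursion fails, since r_0 = 1 while the earlier terms are 0;
    -- the vanishing binomials rescue the weighted one.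
    ... | inj₂ n<k = begin
      (n C k) * ρ (suc n) k                   ≡⟨ cong (_* ρ (suc n) k) nCk≡0 ⟩
      0                                       ≡⟨ lem f c k ⟨
      f * 0 + c * (suc k * 0)                 ≡⟨ cong₂ (λ x y → f * (x * ρ n k) + c * (suc k * (y * ρ n (suc k)))) nCk≡0 nC[k+1]≡0 ⟨
      f * P k n + c * (suc k * P (suc k) n)   ∎
      where
      open ≡-Reasoning
      nCk≡0 : n C k ≡ 0
      nCk≡0 = k>n⇒nCk≡0 n<k
      nC[k+1]≡0 : n C suc k ≡ 0
      nC[k+1]≡0 = k>n⇒nCk≡0 (m<n⇒m<1+n n<k)
      lem : ∀ f c k → f * 0 + c * (suc k * 0) ≡ 0
      lem = solve-∀
    ... | inj₁ k≤n with m≤n⇒∃[o]m+o≡n k≤n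
    ...   | d , refl = begin
      b * ρ (suc (k + d)) k                          ≡⟨ cong (b *_) (trans (cong₂ ρ (sym (+-suc k d)) (sym (+-identityʳ k))) (ρ-+ k (suc d) 0)) ⟩
      b * ρ (suc d) 0                                ≡⟨ cong (b *_) (ρ-suc d) ⟩
      b * (f * ρ d 0 + c * (d * ρ d 1))              ≡⟨ lem b f (ρ d 0) c d (ρ d 1) ⟩
      f * (b * ρ d 0) + c * (d * b * ρ d 1)          ≡⟨ cong₂ (λ x y → f * (b * x) + c * y)
                                                          (trans (sym (ρ-+ k d 0)) (cong (ρ (k + d)) (+-identityʳ k)))
                                                          (cong₂ _*_ (sym (C-absorb-+ d k)) (trans (sym (ρ-+ k d 1)) (cong (ρ (k + d)) (+-comm k 1)))) ⟩
      f * P k (k + d) + c * (suc k * ((k + d) C suc k) * ρ (k + d) (suc k)) ≡⟨ cong (λ x → f * P k (k + d) + c * x) (*-assoc (suc k) ((k + d) C suc k) _) ⟩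
      f * P k (k + d) + c * (suc k * P (suc k) (k + d)) ∎
      where
      open ≡-Reasoning
      b : ℕ
      b = (k + d) C k
      lem : ∀ b f x c d y → b * (f * x + c * (d * y)) ≡ f * (b * x) + c * (d * b * y)
      lem = solve-∀

    -- Pascal's rule splits off `P k n`, and `C-ρ-suc` rewrites the other half.
    P-suc : ∀ k n → P (suc k) (suc n) ≡ P k n + (f * P (suc k) n + c * ((2 + k) * P (2 + k) n))
    P-suc k n = begin
      (suc n C suc k) * ρ n k                     ≡⟨ cong (_* ρ n k) (nCk+nC[k+1]≡[n+1]C[k+1] n k) ⟨
      ((n C k) + (n C suc k)) * ρ n k             ≡⟨ *-distribʳ-+ (ρ n k) (n C k) _ ⟩
      P k n + (n C suc k) * ρ n k                 ≡⟨ cong (P k n +_) (C-ρ-suc (suc k) n) ⟩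
      P k n + (f * P (suc k) n + c * ((2 + k) * P (2 + k) n)) ∎
      where open ≡-Reasoning

    P0 : ∀ n → P 0 n ≡ ρ n 0
    P0 n = *-identityˡ _

    P1 : ∀ n → P 1 n ≡ n * ρ n 1
    P1 n = cong (_* ρ n 1) (nC1≡n n)

    ρ-suc-P : ∀ n → ρ (suc n) 0 ≡ f * ρ n 0 + c * P 1 n
    ρ-suc-P n = trans (ρ-suc n) (cong (λ x → f * ρ n 0 + c * x) (sym (P1 n)))

    -- Nonzero colors at a given position.

    coloredAt : ∀ {n} → Fin n → ColWord n c → ℕ
    coloredAt j τ = 𝟙 (colored (lookup (proj₂ τ) j))

    -- #{τ : c_j ≠ 0}, which does not depend on the position j (Σ-coloredAt).
    coloredCount : ℕ → ℕ
    coloredCount zero    = 0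
    coloredCount (suc n) = g * ρ n 0 + m * P 1 n

    -- Both sides count involutions with a marked position: it is a fixed point with one of `f`
    -- colors, or one of the two ends of a 2-cycle with one of `c` colorings. The proof multiplies
    -- the recursion for r_n by n and absorbs.
    n*ρ : ∀ n → n * ρ n 0 ≡ f * P 1 n + 2 * c * P 2 n
    n*ρ zero    = lem f c
      where
      lem : ∀ f c → 0 ≡ f * 0 + 2 * c * 0
      lem = solve-∀
    n*ρ (suc n) = begin
      suc n * ρ (suc n) 0                         ≡⟨ cong (suc n *_) (ρ-suc-P n) ⟩
      suc n * (f * ρ n 0 + c * P 1 n)             ≡⟨ lem₁ (suc n) f (ρ n 0) c (P 1 n) ⟩
      f * (suc n * ρ n 0) + c * (suc n * P 1 n)   ≡⟨ cong₂ (λ x y → f * x + c * y) (sym (P1 (suc n))) (P-pred 1 n) ⟩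
      f * P 1 (suc n) + c * (2 * P 2 (suc n))     ≡⟨ lem₂ f (P 1 (suc n)) c (P 2 (suc n)) ⟩
      f * P 1 (suc n) + 2 * c * P 2 (suc n)       ∎
      where
      open ≡-Reasoning
      lem₁ : ∀ n f x c y → n * (f * x + c * y) ≡ f * (n * x) + c * (n * y)
      lem₁ = solve-∀
      lem₂ : ∀ f x c y → f * x + c * (2 * y) ≡ f * x + 2 * c * y
      lem₂ = solve-∀

    -- The total number of nonzero colors: a fixed point has `g` of them to choose from, and each of
    -- the `m` nontrivial colorings of a 2-cycle marks both of its ends.
    n*coloredCount : ∀ n → n * coloredCount n ≡ g * P 1 n + 2 * m * P 2 n
    n*coloredCount zero    = lem g m
      where
      lem : ∀ g m → 0 ≡ g * 0 + 2 * m * 0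
      lem = solve-∀
    n*coloredCount (suc n) = begin
      suc n * (g * ρ n 0 + m * P 1 n)             ≡⟨ lem₁ (suc n) g (ρ n 0) m (P 1 n) ⟩
      g * (suc n * ρ n 0) + m * (suc n * P 1 n)   ≡⟨ cong₂ (λ x y → g * x + m * y) (sym (P1 (suc n))) (P-pred 1 n) ⟩
      g * P 1 (suc n) + m * (2 * P 2 (suc n))     ≡⟨ lem₂ g (P 1 (suc n)) m (P 2 (suc n)) ⟩
      g * P 1 (suc n) + 2 * m * P 2 (suc n)       ∎
      where
      open ≡-Reasoning
      lem₁ : ∀ n f x c y → n * (f * x + c * y) ≡ f * (n * x) + c * (n * y)
      lem₁ = solve-∀
      lem₂ : ∀ f x c y → f * x + c * (2 * y) ≡ f * x + 2 * c * y
      lem₂ = solve-∀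

    -- Independence of `j` comes out of an induction over the decomposition. For position `suc j`, a
    -- fixed first letter leaves position `j` of the rest; in a cycle, the partner `j` admits `m`
    -- nonzero colors, and each of the `n` other partners leaves an old position with `c` free
    -- colors. The formula for `n * coloredCount n` then closes the recursion.
    Σ-coloredAt : ∀ n (j : Fin n) → Σₗ (involutions n) (coloredAt j) ≡ coloredCount n
    Σ-coloredAt (suc n) zero = begin
      Σₗ (involutions (suc n)) (coloredAt zero)   ≡⟨ Σ-involutions-suc n (coloredAt zero) ⟩
      Σₗ selfInverse (λ a → Σₗ (involutions n) (λ _ → 𝟙 (colored a))) + Σₗ (withCycle n) (coloredAt zero)
        ≡⟨ cong₂ _+_ fixed (cycle n) ⟩
      g * ρ n 0 + m * P 1 n                       ∎
      where
      open ≡-Reasoning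
      fixed : Σₗ selfInverse (λ a → Σₗ (involutions n) (λ _ → 𝟙 (colored a))) ≡ g * ρ n 0
      fixed = begin
        Σₗ selfInverse (λ a → Σₗ (involutions n) (λ _ → 𝟙 (colored a)))  ≡⟨ Σₗ-cong {xs = selfInverse} (λ {a} _ → Σₗ-const (involutions n) (𝟙 (colored a))) ⟩
        Σₗ selfInverse (λ a → ρ n 0 * 𝟙 (colored a))                     ≡⟨ Σₗ-*ˡ selfInverse (ρ n 0) _ ⟩
        ρ n 0 * g                                                        ≡⟨ *-comm (ρ n 0) g ⟩
        g * ρ n 0                                                        ∎
      cycle : ∀ n → Σₗ (withCycle n) (coloredAt zero) ≡ m * P 1 n
      cycle zero    = sym (*-zeroʳ m)
      cycle (suc n) = begin
        Σₗ (withCycle (suc n)) (coloredAt zero)  ≡⟨ Σ-withCycle n (coloredAt zero) ⟩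
        ∑ {suc n} (λ _ → ∑ {c} λ a → Σₗ (involutions n) (λ _ → 𝟙 (colored a))) ≡⟨ ∑-const (suc n) _ ⟩
        suc n * ∑ {c} (λ a → Σₗ (involutions n) (λ _ → 𝟙 (colored a))) ≡⟨ cong (suc n *_) (sum-cong-≗ {c} λ a → Σₗ-const (involutions n) (𝟙 (colored a))) ⟩
        suc n * ∑ {c} (λ a → ρ n 0 * 𝟙 (colored a)) ≡⟨ cong (suc n *_) (*-distribˡ-sum {c} (ρ n 0) (𝟙 ∘ colored)) ⟨
        suc n * (ρ n 0 * ∑ {c} (λ a → 𝟙 (colored a))) ≡⟨ cong (λ x → suc n * (ρ n 0 * x)) ∑-colored ⟩
        suc n * (ρ n 0 * m) ≡⟨ trans (sym (*-assoc (suc n) (ρ n 0) m)) (*-comm _ m) ⟩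
        m * (suc n * ρ n 0) ≡⟨ cong (m *_) (P1 (suc n)) ⟨
        m * P 1 (suc n) ∎
    Σ-coloredAt (suc (suc n)) (suc j) = begin
      Σₗ (involutions (2 + n)) (coloredAt (suc j)) ≡⟨ Σ-involutions-suc (suc n) (coloredAt (suc j)) ⟩
      Σₗ selfInverse (λ _ → Σₗ (involutions (suc n)) (coloredAt j)) + Σₗ (withCycle (suc n)) (coloredAt (suc j))
        ≡⟨ cong₂ _+_ (trans (Σₗ-const selfInverse _) (cong (f *_) (Σ-coloredAt (suc n) j)))
             (trans (Σ-withCycle n (coloredAt (suc j))) (trans (sum-remove {i = j} partner) (cong₂ _+_ partner-j (trans (sum-cong-≗ partner-≢j) (∑-const n _))))) ⟩
      f * (g * ρ n 0 + m * P 1 n) + (m * ρ n 0 + n * (c * coloredCount n))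
        ≡⟨ lem₁ f g (ρ n 0) m (P 1 n) n (coloredCount n) ⟩
      f * (g * ρ n 0 + m * P 1 n) + m * ρ n 0 + c * (n * coloredCount n)
        ≡⟨ cong (λ x → f * (g * ρ n 0 + m * P 1 n) + m * ρ n 0 + c * x) (n*coloredCount n) ⟩
      f * (g * ρ n 0 + m * P 1 n) + m * ρ n 0 + c * (g * P 1 n + 2 * m * P 2 n)
        ≡⟨ lem₂ f g (ρ n 0) m (P 1 n) (P 2 n) ⟩
      g * (f * ρ n 0 + c * P 1 n) + m * (ρ n 0 + (f * P 1 n + c * (2 * P 2 n)))
        ≡⟨ cong₂ (λ x y → g * x + m * y) (sym (ρ-suc-P n)) (trans (cong (_+ (f * P 1 n + c * (2 * P 2 n))) (sym (P0 n))) (sym (P-suc 0 n))) ⟩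
      g * ρ (suc n) 0 + m * P 1 (suc n) ∎
      where
      open ≡-Reasoning
      partner : Fin (suc n) → ℕ
      partner k = ∑ λ a → Σₗ (involutions n) (coloredAt (suc j) ∘ addCycle k a)
      partner-j : partner j ≡ m * ρ n 0
      partner-j = begin
        partner j ≡⟨ sum-cong-≗ {c} (λ a → Σₗ-cong {xs = involutions n} λ {τ} _ →
                       trans (cong (𝟙 ∘ colored) (addCycle-col-partner j a τ)) (cong 𝟙 (colored-neg a))) ⟩
        ∑ {c} (λ a → Σₗ (involutions n) (λ _ → 𝟙 (colored a))) ≡⟨ sum-cong-≗ {c} (λ a → Σₗ-const (involutions n) (𝟙 (colored a))) ⟩
        ∑ {c} (λ a → ρ n 0 * 𝟙 (colored a)) ≡⟨ *-distribˡ-sum {c} (ρ n 0) (𝟙 ∘ colored) ⟨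
        ρ n 0 * ∑ {c} (λ a → 𝟙 (colored a)) ≡⟨ cong (ρ n 0 *_) ∑-colored ⟩
        ρ n 0 * m ≡⟨ *-comm (ρ n 0) m ⟩
        m * ρ n 0 ∎
      partner-≢j : ∀ k → partner (punchIn j k) ≡ c * coloredCount n
      -- The partner here differs from `j`, so `j` is an old position; `l` is its index before the
      -- insertion.
      partner-≢j k with punchIn-surj (punchIn j k) j
      ... | inj₁ j≡ with () ← punchInᵢ≢i j k (sym j≡)
      ... | inj₂ (l , j≡) = trans (sum-cong-≗ {c} λ a → trans (Σₗ-cong {xs = involutions n} λ {τ} _ →
              cong (𝟙 ∘ colored) (trans (cong (λ x → lookup (proj₂ (addCycle (punchIn j k) a τ)) (suc x)) j≡)
                (addCycle-col-old (punchIn j k) a τ l))) (Σ-coloredAt n l)) (∑-const c _)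
      lem₁ : ∀ f g r m p n e → f * (g * r + m * p) + (m * r + n * (suc m * e)) ≡ f * (g * r + m * p) + m * r + suc m * (n * e)
      lem₁ = solve-∀
      lem₂ : ∀ f g r m p q → f * (g * r + m * p) + m * r + suc m * (g * p + 2 * m * q) ≡
             g * (f * r + suc m * p) + m * (r + (f * p + suc m * (2 * q)))
      lem₂ = solve-∀

    -- The recursion for the total of inv_c, and its solution.

    totalInvc : ℕ → ℕ
    totalInvc n = Σₗ (involutions n) (invc c)

    Σ-withFixed-invc : ∀ n → Σₗ selfInverse (λ a → Σₗ (involutions n) (invc c ∘ addFixed a)) ≡
      h * ρ n 0 + f * (totalInvc n + c * (n * coloredCount n))
    Σ-withFixed-invc n = begin
      Σₗ selfInverse (λ a → Σₗ (involutions n) (invc c ∘ addFixed a))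
        ≡⟨ Σₗ-cong {xs = selfInverse} (λ {a} _ → begin
             Σₗ (involutions n) (invc c ∘ addFixed a)
               ≡⟨ Σₗ-cong {xs = involutions n} (λ {τ} _ → trans (invc-addFixed a τ) (+-assoc (toℕ a) _ _)) ⟩
             Σₗ (involutions n) (λ τ → toℕ a + (invc c τ + c * ∑ (λ j → coloredAt j τ)))
               ≡⟨ Σₗ-+ (involutions n) (λ _ → toℕ a) _ ⟩
             Σₗ (involutions n) (λ _ → toℕ a) + Σₗ (involutions n) (λ τ → invc c τ + c * ∑ (λ j → coloredAt j τ))
               ≡⟨ cong₂ _+_ (Σₗ-const (involutions n) (toℕ a)) (Σₗ-+ (involutions n) (invc c) _) ⟩
             ρ n 0 * toℕ a + (totalInvc n + Σₗ (involutions n) (λ τ → c * ∑ (λ j → coloredAt j τ)))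
               ≡⟨ cong (λ x → ρ n 0 * toℕ a + (totalInvc n + x)) (trans (Σₗ-*ˡ (involutions n) c _) (cong (c *_)
                    (trans (Σₗ-∑ (involutions n) (λ τ j → coloredAt j τ)) (trans (sum-cong-≗ (Σ-coloredAt n)) (∑-const n _))))) ⟩
             ρ n 0 * toℕ a + (totalInvc n + c * (n * coloredCount n)) ∎) ⟩
      Σₗ selfInverse (λ a → ρ n 0 * toℕ a + (totalInvc n + c * (n * coloredCount n)))
        ≡⟨ Σₗ-+ selfInverse (λ a → ρ n 0 * toℕ a) _ ⟩
      Σₗ selfInverse (λ a → ρ n 0 * toℕ a) + Σₗ selfInverse (λ _ → totalInvc n + c * (n * coloredCount n))
        ≡⟨ cong₂ _+_ (trans (Σₗ-*ˡ selfInverse (ρ n 0) toℕ) (*-comm (ρ n 0) h)) (Σₗ-const selfInverse _) ⟩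
      h * ρ n 0 + f * (totalInvc n + c * (n * coloredCount n)) ∎
      where open ≡-Reasoning

    -- Summed over the `suc n` partners, the odd numbers `1 + 2 * toℕ k` give a square. In the last
    -- term the sums over partners and positions are exchanged, because for a fixed position
    -- `above-count` is explicit; the 2 from the doubled ascents clears the half of the triangular
    -- number. One factor `c` there is the weight in inv_c, the other the free choice of the color.
    Σ-withCycle-invc : ∀ n → Σₗ (withCycle (suc n)) (invc c) ≡
      suc n * suc n * (c * ρ n 0) + suc n * (m * c * ρ n 0) + suc n * (c * totalInvc n) + c * c * (n * suc n * coloredCount n)
    Σ-withCycle-invc n = begin
      Σₗ (withCycle (suc n)) (invc c)
        ≡⟨ Σ-withCycle n (invc c) ⟩
      ∑ {suc n} (λ k → ∑ {c} λ a → Σₗ (involutions n) (invc c ∘ addCycle k a))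
        ≡⟨ sum-cong-≗ {suc n} (λ k → trans (sum-cong-≗ {c} (per-cycle k)) (per-partner k)) ⟩
      ∑ {suc n} (λ k → (1 + 2 * toℕ k) * (c * ρ n 0) + (K + 2 * c * c * e * ∑ (above k)))
        ≡⟨ ∑-distrib-+ {suc n} (λ k → (1 + 2 * toℕ k) * (c * ρ n 0)) (λ k → K + 2 * c * c * e * ∑ (above k)) ⟩
      ∑ {suc n} (λ k → (1 + 2 * toℕ k) * (c * ρ n 0)) + ∑ {suc n} (λ k → K + 2 * c * c * e * ∑ (above k))
        ≡⟨ cong₂ _+_ (trans (sym (*-distribʳ-sum {suc n} (c * ρ n 0) (λ k → 1 + 2 * toℕ k))) (cong (_* (c * ρ n 0)) (odd-sum (suc n))))
             (trans (∑-distrib-+ {suc n} (λ _ → K) (λ k → 2 * c * c * e * ∑ (above k))) (cong₂ _+_ (∑-const (suc n) K)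
               (trans (sym (*-distribˡ-sum {suc n} (2 * c * c * e) (λ k → ∑ (above k)))) (cong (2 * c * c * e *_)
                 (trans (∑-comm {suc n} {n} above) (sum-cong-≗ {n} above-count)))))) ⟩
      suc n * suc n * (c * ρ n 0) + (suc n * K + 2 * c * c * e * T)
        ≡⟨ lem₁ (suc n) (ρ n 0) m (totalInvc n) e T ⟩
      suc n * suc n * (c * ρ n 0) + suc n * (m * c * ρ n 0) + suc n * (c * totalInvc n) + c * c * (2 * T * e)
        ≡⟨ cong (λ x → suc n * suc n * (c * ρ n 0) + suc n * (m * c * ρ n 0) + suc n * (c * totalInvc n) + c * c * (x * e)) (triangular n) ⟩
      suc n * suc n * (c * ρ n 0) + suc n * (m * c * ρ n 0) + suc n * (c * totalInvc n) + c * c * (n * suc n * e) ∎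
      where
      open ≡-Reasoning
      e T K : ℕ
      e = coloredCount n
      T = ∑ {n} (λ j → suc (toℕ j))
      K = m * c * ρ n 0 + c * totalInvc n
      above : Fin (suc n) → Fin n → ℕ
      above k j = 𝟙 (k <ᶠ punchIn k j)
      per-cycle : ∀ k a → Σₗ (involutions n) (invc c ∘ addCycle k a) ≡
        ρ n 0 * (toℕ a + toℕ (neg a)) + ((1 + 2 * toℕ k) * ρ n 0 + totalInvc n + 2 * c * (e * ∑ (above k)))
      per-cycle k a = begin
        Σₗ (involutions n) (invc c ∘ addCycle k a)
          ≡⟨ Σₗ-cong {xs = involutions n} (λ {τ} τ∈ → trans (invc-addCycle {n} {τ} (Equivalence.to ∈-involutions τ∈) k a)
               (lem₂ (1 + 2 * toℕ k) (toℕ a + toℕ (neg a)) (invc c τ) c (A τ))) ⟩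
        Σₗ (involutions n) (λ τ → z + (invc c τ + 2 * c * A τ))
          ≡⟨ Σₗ-+ (involutions n) (λ _ → z) _ ⟩
        Σₗ (involutions n) (λ _ → z) + Σₗ (involutions n) (λ τ → invc c τ + 2 * c * A τ)
          ≡⟨ cong₂ _+_ (Σₗ-const (involutions n) z) (trans (Σₗ-+ (involutions n) (invc c) _)
               (cong (totalInvc n +_) (trans (Σₗ-*ˡ (involutions n) (2 * c) A) (cong (2 * c *_) Σ-A)))) ⟩
        ρ n 0 * z + (totalInvc n + 2 * c * (e * ∑ (above k)))
          ≡⟨ lem₃ (ρ n 0) (1 + 2 * toℕ k) (toℕ a + toℕ (neg a)) (totalInvc n) (2 * c * (e * ∑ (above k))) ⟩
        ρ n 0 * (toℕ a + toℕ (neg a)) + ((1 + 2 * toℕ k) * ρ n 0 + totalInvc n + 2 * c * (e * ∑ (above k))) ∎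
        where
        z : ℕ
        z = 1 + 2 * toℕ k + (toℕ a + toℕ (neg a))
        A : ColWord n c → ℕ
        A τ = ∑ (λ j → above k j * coloredAt j τ)
        Σ-A : Σₗ (involutions n) A ≡ e * ∑ (above k)
        Σ-A = begin
          Σₗ (involutions n) A                                       ≡⟨ Σₗ-∑ (involutions n) (λ τ j → above k j * coloredAt j τ) ⟩
          ∑ (λ j → Σₗ (involutions n) (λ τ → above k j * coloredAt j τ)) ≡⟨ sum-cong-≗ (λ j → trans (Σₗ-*ˡ (involutions n) (above k j) (coloredAt j))
                                                                            (trans (cong (above k j *_) (Σ-coloredAt n j)) (*-comm (above k j) e))) ⟩
          ∑ (λ j → e * above k j)                                    ≡⟨ *-distribˡ-sum e (above k) ⟨
          e * ∑ (above k)                                            ∎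
        lem₂ : ∀ k a i c s → k + a + i + c * (2 * s) ≡ k + a + (i + 2 * c * s)
        lem₂ = solve-∀
        lem₃ : ∀ r k a i x → r * (k + a) + (i + x) ≡ r * a + (k * r + i + x)
        lem₃ = solve-∀
      per-partner : ∀ k →
        ∑ {c} (λ a → ρ n 0 * (toℕ a + toℕ (neg a)) + ((1 + 2 * toℕ k) * ρ n 0 + totalInvc n + 2 * c * (e * ∑ (above k)))) ≡
        (1 + 2 * toℕ k) * (c * ρ n 0) + (K + 2 * c * c * e * ∑ (above k))
      per-partner k = trans (∑-distrib-+ {c} (λ a → ρ n 0 * (toℕ a + toℕ (neg a))) (λ _ → (1 + 2 * toℕ k) * ρ n 0 + totalInvc n + 2 * c * (e * ∑ (above k)))) (trans
        (cong₂ _+_ (trans (sym (*-distribˡ-sum {c} (ρ n 0) (λ a → toℕ a + toℕ (neg a)))) (cong (ρ n 0 *_) ∑-color+neg)) (∑-const c _))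
        (lem₄ (ρ n 0) m (1 + 2 * toℕ k) (totalInvc n) e (∑ (above k))))
        where
        lem₄ : ∀ r m k i e s → r * (m * suc m) + suc m * (k * r + i + 2 * suc m * (e * s)) ≡
               k * (suc m * r) + (m * suc m * r + suc m * i + 2 * suc m * suc m * e * s)
        lem₄ = solve-∀
      lem₁ : ∀ n r m i e t → n * n * (suc m * r) + (n * (m * suc m * r + suc m * i) + 2 * suc m * suc m * e * t) ≡
             n * n * (suc m * r) + n * (m * suc m * r) + n * (suc m * i) + suc m * suc m * (2 * t * e)
      lem₁ = solve-∀

    -- Written with `f`, `g`, `h`, the claim has neither signs nor fractions: `h` stands for
    -- c((-1)^c + 1)/4, `c + f * g` for c + 1 + (-1)^c and `f + g` for (-1)^c + 2. The product
    -- `f * g`, rather than the equal `2 * g`, is what the recursion produces.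
    closedForm : ℕ → ℕ
    closedForm n = h * P 1 n + c * (c + f * g) * P 2 n + 2 * c * c * (f + g) * P 3 n + 6 * c * c * c * P 4 n

    totalInvc-zero : totalInvc 0 ≡ 0
    totalInvc-zero = trans (Σₗ-cong {xs = involutions 0} {G = λ _ → 0} λ { {[]ᵥ , []ᵥ} _ → *-zeroʳ c })
      (trans (Σₗ-const (involutions 0) 0) (*-zeroʳ (length (involutions 0))))

    totalInvc≡closedForm : ∀ n → totalInvc n ≡ closedForm n
    totalInvc≡closedForm zero = trans totalInvc-zero (sym (lem h c (c * (c + f * g)) (f + g)))
      where
      lem : ∀ h c x y → h * 0 + x * 0 + 2 * c * c * y * 0 + 6 * c * c * c * 0 ≡ 0
      lem = solve-∀
    totalInvc≡closedForm (suc zero) = begin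
      totalInvc 1                                                   ≡⟨ Σ-involutions-suc 0 (invc c) ⟩
      Σₗ selfInverse (λ a → Σₗ (involutions 0) (invc c ∘ addFixed a)) + 0 ≡⟨ +-identityʳ _ ⟩
      Σₗ selfInverse (λ a → Σₗ (involutions 0) (invc c ∘ addFixed a)) ≡⟨ Σ-withFixed-invc 0 ⟩
      h * ρ 0 0 + f * (totalInvc 0 + c * 0)                         ≡⟨ cong (λ x → h * ρ 0 0 + f * (x + c * 0)) totalInvc-zero ⟩
      h * ρ 0 0 + f * (0 + c * 0)                           ≡⟨ lem h (ρ 0 0) f g c ⟩
      closedForm 1                                          ∎
      where
      open ≡-Reasoning
      lem : ∀ h r f g c → h * r + f * (0 + c * 0) ≡
            h * (1 * r) + c * (c + f * g) * 0 + 2 * c * c * (f + g) * 0 + 6 * c * c * c * 0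
      lem = solve-∀
    totalInvc≡closedForm (suc (suc n)) = begin
      totalInvc (2 + n)
        ≡⟨ Σ-involutions-suc (suc n) (invc c) ⟩
      Σₗ selfInverse (λ a → Σₗ (involutions (suc n)) (invc c ∘ addFixed a)) + Σₗ (withCycle (suc n)) (invc c)
        ≡⟨ cong₂ _+_ (Σ-withFixed-invc (suc n)) (Σ-withCycle-invc n) ⟩
      h * ρ N 0 + f * (totalInvc N + c * (N * coloredCount N)) +
        (N * N * (c * ρ n 0) + N * (m * c * ρ n 0) + N * (c * totalInvc n) + c * c * (n * N * coloredCount n))
        ≡⟨ cong₂ (λ x y → h * ρ N 0 + f * (x + c * (N * coloredCount N)) +
             (N * N * (c * ρ n 0) + N * (m * c * ρ n 0) + N * (c * y) + c * c * (n * N * coloredCount n)))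
             (totalInvc≡closedForm (suc n)) (totalInvc≡closedForm n) ⟩
      h * ρ N 0 + f * (closedForm N + c * (N * coloredCount N)) +
        (N * N * (c * ρ n 0) + N * (m * c * ρ n 0) + N * (c * closedForm n) + c * c * (n * N * coloredCount n))
        -- Since N + m = n + c, the two r_n terms regroup into multiples of `N * (n * ρ n 0)` and
        -- `N * ρ n 0`, both of which are combinations of the `P k N`.
        ≡⟨ lem₁ h (ρ N 0) f g m (closedForm N) (N * coloredCount N) n (ρ n 0) (coloredCount n) (P 1 n) (P 2 n) (P 3 n) (P 4 n) ⟩
      h * ρ N 0 + f * (closedForm N + c * (N * coloredCount N)) +
        (c * (N * (n * ρ n 0)) + c * c * (N * ρ n 0)
          + c * (h * (N * P 1 n) + c * (c + f * g) * (N * P 2 n) + 2 * c * c * (f + g) * (N * P 3 n) + 6 * c * c * c * (N * P 4 n))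
          + c * c * (N * (n * coloredCount n)))
        ≡⟨ cong₂ (λ x y → h * x + f * (closedForm N + c * (N * coloredCount N)) +
             (c * (N * (n * ρ n 0)) + c * c * y
               + c * (h * (N * P 1 n) + c * (c + f * g) * (N * P 2 n) + 2 * c * c * (f + g) * (N * P 3 n) + 6 * c * c * c * (N * P 4 n))
               + c * c * (N * (n * coloredCount n)))) (sym (P0 N)) (sym (P1 N)) ⟩
      h * P 0 N + f * (closedForm N + c * (N * coloredCount N)) +
        (c * (N * (n * ρ n 0)) + c * c * P 1 N
          + c * (h * (N * P 1 n) + c * (c + f * g) * (N * P 2 n) + 2 * c * c * (f + g) * (N * P 3 n) + 6 * c * c * c * (N * P 4 n))
          + c * c * (N * (n * coloredCount n)))
        ≡⟨ cong₂ (λ x y → h * P 0 N + f * (closedForm N + c * x) + (c * y + c * c * P 1 N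
               + c * (h * (N * P 1 n) + c * (c + f * g) * (N * P 2 n) + 2 * c * c * (f + g) * (N * P 3 n) + 6 * c * c * c * (N * P 4 n))
               + c * c * (N * (n * coloredCount n)))) (n*coloredCount N) N*n*ρ ⟩
      h * P 0 N + f * (closedForm N + c * (g * P 1 N + 2 * m * P 2 N)) +
        (c * (2 * f * P 2 N + 6 * c * P 3 N) + c * c * P 1 N
          + c * (h * (N * P 1 n) + c * (c + f * g) * (N * P 2 n) + 2 * c * c * (f + g) * (N * P 3 n) + 6 * c * c * c * (N * P 4 n))
          + c * c * (N * (n * coloredCount n)))
        ≡⟨ cong₂ (λ x y → h * P 0 N + f * (closedForm N + c * (g * P 1 N + 2 * m * P 2 N)) +
             (c * (2 * f * P 2 N + 6 * c * P 3 N) + c * c * P 1 N + c * x + c * c * y))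
             (cong₂ _+_ (cong₂ _+_ (cong₂ (λ x y → h * x + c * (c + f * g) * y) (P-pred 1 n) (P-pred 2 n))
                (cong (2 * c * c * (f + g) *_) (P-pred 3 n))) (cong (6 * c * c * c *_) (P-pred 4 n))) N*n*coloredCount ⟩
      h * P 0 N + f * (closedForm N + c * (g * P 1 N + 2 * m * P 2 N)) +
        (c * (2 * f * P 2 N + 6 * c * P 3 N) + c * c * P 1 N
          + c * (h * (2 * P 2 N) + c * (c + f * g) * (3 * P 3 N) + 2 * c * c * (f + g) * (4 * P 4 N) + 6 * c * c * c * (5 * P 5 N))
          + c * c * (2 * g * P 2 N + 6 * m * P 3 N))
        -- Everything is now expressed at argument `N`; what is left is a polynomial identity in
        -- which `h`, `f`, `g`, `m` and the `P k N` are independent.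
        ≡⟨ lem₂ h f g m (P 0 N) (P 1 N) (P 2 N) (P 3 N) (P 4 N) (P 5 N) ⟩
      h * (P 0 N + (f * P 1 N + c * (2 * P 2 N))) + c * (c + f * g) * (P 1 N + (f * P 2 N + c * (3 * P 3 N)))
        + 2 * c * c * (f + g) * (P 2 N + (f * P 3 N + c * (4 * P 4 N))) + 6 * c * c * c * (P 3 N + (f * P 4 N + c * (5 * P 5 N)))
        ≡⟨ cong₂ _+_ (cong₂ _+_ (cong₂ (λ x y → h * x + c * (c + f * g) * y) (P-suc 0 N) (P-suc 1 N))
                (cong (2 * c * c * (f + g) *_) (P-suc 2 N))) (cong (6 * c * c * c *_) (P-suc 3 N)) ⟨
      closedForm (2 + n) ∎
      where
      open ≡-Reasoning
      N : ℕ
      N = suc n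
      push : ∀ x y p q → N * (x * p + y * q) ≡ x * (N * p) + y * (N * q)
      push x y p q = lem n x y p q
        where
        lem : ∀ n x y p q → suc n * (x * p + y * q) ≡ x * (suc n * p) + y * (suc n * q)
        lem = solve-∀
      N*n*ρ : N * (n * ρ n 0) ≡ 2 * f * P 2 N + 6 * c * P 3 N
      N*n*ρ = begin
        N * (n * ρ n 0)                         ≡⟨ cong (N *_) (n*ρ n) ⟩
        N * (f * P 1 n + 2 * c * P 2 n)         ≡⟨ push f (2 * c) (P 1 n) (P 2 n) ⟩
        f * (N * P 1 n) + 2 * c * (N * P 2 n)   ≡⟨ cong₂ (λ x y → f * x + 2 * c * y) (P-pred 1 n) (P-pred 2 n) ⟩
        f * (2 * P 2 N) + 2 * c * (3 * P 3 N)   ≡⟨ lem f (P 2 N) c (P 3 N) ⟩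
        2 * f * P 2 N + 6 * c * P 3 N           ∎
        where
        lem : ∀ f p c q → f * (2 * p) + 2 * c * (3 * q) ≡ 2 * f * p + 6 * c * q
        lem = solve-∀
      N*n*coloredCount : N * (n * coloredCount n) ≡ 2 * g * P 2 N + 6 * m * P 3 N
      N*n*coloredCount = begin
        N * (n * coloredCount n)                ≡⟨ cong (N *_) (n*coloredCount n) ⟩
        N * (g * P 1 n + 2 * m * P 2 n)         ≡⟨ push g (2 * m) (P 1 n) (P 2 n) ⟩
        g * (N * P 1 n) + 2 * m * (N * P 2 n)   ≡⟨ cong₂ (λ x y → g * x + 2 * m * y) (P-pred 1 n) (P-pred 2 n) ⟩
        g * (2 * P 2 N) + 2 * m * (3 * P 3 N)   ≡⟨ lem g (P 2 N) m (P 3 N) ⟩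
        2 * g * P 2 N + 6 * m * P 3 N           ∎
        where
        lem : ∀ f p c q → f * (2 * p) + 2 * c * (3 * q) ≡ 2 * f * p + 6 * c * q
        lem = solve-∀
      lem₁ : ∀ h R f g m F e n r k p₁ p₂ p₃ p₄ →
        h * R + f * (F + suc m * e) + (suc n * suc n * (suc m * r) + suc n * (m * suc m * r)
          + suc n * (suc m * (h * p₁ + suc m * (suc m + f * g) * p₂ + 2 * suc m * suc m * (f + g) * p₃ + 6 * suc m * suc m * suc m * p₄))
          + suc m * suc m * (n * suc n * k)) ≡
        h * R + f * (F + suc m * e) + (suc m * (suc n * (n * r)) + suc m * suc m * (suc n * r)
          + suc m * (h * (suc n * p₁) + suc m * (suc m + f * g) * (suc n * p₂) + 2 * suc m * suc m * (f + g) * (suc n * p₃) + 6 * suc m * suc m * suc m * (suc n * p₄))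
          + suc m * suc m * (suc n * (n * k)))
      lem₁ = solve-∀
      lem₂ : ∀ h f g m p₀ p₁ p₂ p₃ p₄ p₅ →
        h * p₀ + f * (h * p₁ + suc m * (suc m + f * g) * p₂ + 2 * suc m * suc m * (f + g) * p₃ + 6 * suc m * suc m * suc m * p₄
            + suc m * (g * p₁ + 2 * m * p₂)) +
          (suc m * (2 * f * p₂ + 6 * suc m * p₃) + suc m * suc m * p₁
            + suc m * (h * (2 * p₂) + suc m * (suc m + f * g) * (3 * p₃) + 2 * suc m * suc m * (f + g) * (4 * p₄) + 6 * suc m * suc m * suc m * (5 * p₅))
            + suc m * suc m * (2 * g * p₂ + 6 * m * p₃)) ≡
        h * (p₀ + (f * p₁ + suc m * (2 * p₂))) + suc m * (suc m + f * g) * (p₁ + (f * p₂ + suc m * (3 * p₃)))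
          + 2 * suc m * suc m * (f + g) * (p₂ + (f * p₃ + suc m * (4 * p₄))) + 6 * suc m * suc m * suc m * (p₃ + (f * p₄ + suc m * (5 * p₅)))
      lem₂ = solve-∀

    -- The self-inverse colors for odd and even c.

    neg-fixed : ∀ a → neg a ≡ a → a ≡ zero ⊎ toℕ a + toℕ a ≡ c
    neg-fixed zero    _  = inj₁ refl
    neg-fixed (suc i) eq = inj₂ (trans (cong (λ b → toℕ (suc i) + toℕ b) (sym eq)) (toℕ-neg-suc i))

    neg-half : ∀ a → toℕ a + toℕ a ≡ c → neg a ≡ a
    neg-half (suc i) eq = toℕ-injective (+-cancelˡ-≡ (toℕ (suc i)) _ _ (trans (toℕ-neg-suc i) (sym eq)))

    ∈-selfInverse : ∀ {a} → a ∈ selfInverse ⇔ neg a ≡ a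
    ∈-selfInverse {a} = mk⇔
      (λ a∈ → proj₂ (∈-filter⁻ (λ a → neg a ≟ a) {xs = allFin c} a∈))
      (λ eq → ∈-filter⁺ (λ a → neg a ≟ a) (∈-allFin a) eq)

    selfInverse-unique : Unique selfInverse
    selfInverse-unique = Uniqueₚ.filter⁺ (λ a → neg a ≟ a) (Uniqueₚ.allFin⁺ c)

    selfInverse-odd : ∀ p → m ≡ 2 * p → selfInverse ↭ [ zero ]
    selfInverse-odd p refl = unique-set⇒↭ selfInverse-unique ([] ∷ []) (mk⇔ to from)
      where
      to : ∀ {a} → a ∈ selfInverse → a ∈ [ zero ]
      to {a} a∈ with neg-fixed a (Equivalence.to ∈-selfInverse a∈)
      ... | inj₁ a≡0 = here a≡0
      ... | inj₂ eq  = contradiction (trans (2*n≡n+n (toℕ a)) eq) (even≢odd (toℕ a) p)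
      from : ∀ {a} → a ∈ [ zero ] → a ∈ selfInverse
      from (here refl) = Equivalence.from ∈-selfInverse refl

    selfInverse-even : ∀ a → toℕ a + toℕ a ≡ c → selfInverse ↭ zero ∷ a ∷ []
    selfInverse-even zero      ()
    selfInverse-even half@(suc _) half+half = unique-set⇒↭ selfInverse-unique (((λ ()) ∷ []) ∷ [] ∷ []) (mk⇔ to from)
      where
      double-injective : ∀ {x y} → x + x ≡ y + y → x ≡ y
      double-injective {x} {y} eq = *-cancelˡ-≡ x y 2 (trans (2*n≡n+n x) (trans eq (sym (2*n≡n+n y))))
      to : ∀ {a} → a ∈ selfInverse → a ∈ zero ∷ half ∷ []
      to {a} a∈ with neg-fixed a (Equivalence.to ∈-selfInverse a∈)
      ... | inj₁ a≡0 = here a≡0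
      ... | inj₂ eq  = there (here (toℕ-injective (double-injective (trans eq (sym half+half)))))
      from : ∀ {a} → a ∈ zero ∷ half ∷ [] → a ∈ selfInverse
      from (here refl)         = Equivalence.from ∈-selfInverse refl
      from (there (here refl)) = Equivalence.from ∈-selfInverse (neg-half half half+half)

-- Transfer to the definitions of the statement.

open Counting
open import Data.Integer using (+_; -1ℤ; 1ℤ; _^_) renaming (_+_ to _+ℤ_; _*_ to _*ℤ_; _-_ to _-ℤ_)
open import Data.Rational using (ℚ; _/_; _+_; _*_; toℚᵘ)
import Data.Integer.Properties as ℤₚ
import Data.Nat as ℕ
import Data.Nat.Properties as ℕₚ
import Data.Rational.Properties as ℚₚ
import Data.Rational.Unnormalised as ℚᵘ
import Data.Rational.Unnormalised.Properties as ℚᵘₚ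

-- The list is a variable with an equation, so the opaque `involutions n` can be put in its place by
-- `involutions≡`.
iNum≡Σ : ∀ n c .{{_ : NonZero c}} {xs} → xs ≡ colInvolutions n c → iNum n c ≡ Σₗ xs (invc c)
iNum≡Σ n c refl = refl

r≡length : ∀ n c .{{_ : NonZero c}} {xs} → xs ≡ colInvolutions n c → r (+ n) c ≡ length xs
r≡length n c refl = refl

-1^[2*n] : ∀ n → -1ℤ ^ (2 ℕ.* n) ≡ 1ℤ
-1^[2*n] n = trans (sym (ℤₚ.^-*-assoc -1ℤ 2 n)) (ℤₚ.^-zeroˡ n)

parity : ∀ n → ∃ λ p → n ≡ 2 ℕ.* p ⊎ n ≡ suc (2 ℕ.* p)
parity zero = 0 , inj₁ refl
parity (suc n) with parity n
... | p , inj₁ eq = p , inj₂ (cong suc eq)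
... | p , inj₂ eq = suc p , inj₁ (trans (cong suc eq) (sym (ℕₚ.*-suc 2 p)))

-- The NonZero instance is named and passed on throughout: comparing two instances, although
-- they are irrelevant, makes Agda unfold the enumeration of involutions.
module _ (m : ℕ) where
  open Coloured m

  private
    c : ℕ
    c = suc m

  -- The triple (f, g, h) is (1, 0, 0) for odd c and (2, 1, c/2) for even c; these relations express
  -- both cases without a case distinction. The second holds because g is 0 or 1.
  ColorRelations : ℕ → ℕ → ℕ → Set
  ColorRelations f g h = f ≡ suc g × f ℕ.* g ≡ 2 ℕ.* g × c ℕ.* g ≡ 2 ℕ.* h × -1ℤ ^ c +ℤ 1ℤ ≡ + (2 ℕ.* g)

  colorRelations-↭ : ∀ {xs} → selfInverse ↭ xs →
    ColorRelations (length xs) (Σₗ xs (𝟙 ∘ colored)) (Σₗ xs toℕ) → ColorRelations f g h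
  colorRelations-↭ p = transport (↭ₚ.↭-length p) (Σₗ-↭ (𝟙 ∘ colored) p) (Σₗ-↭ toℕ p)
    where
    transport : ∀ {f g h f′ g′ h′} → f ≡ f′ → g ≡ g′ → h ≡ h′ → ColorRelations f′ g′ h′ → ColorRelations f g h
    transport refl refl refl rel = rel

  colorRelations : ColorRelations f g h
  colorRelations with parity m
  ... | p , inj₁ m≡2p = colorRelations-↭ (selfInverse-odd p m≡2p)
    (refl , refl , ℕₚ.*-zeroʳ c , cong (λ z → -1ℤ *ℤ z +ℤ 1ℤ) (trans (cong (-1ℤ ^_) m≡2p) (-1^[2*n] p)))
  ... | p , inj₂ m≡1+2p = colorRelations-↭ (selfInverse-even half half+half)
    (refl , refl , trans (ℕₚ.*-identityʳ c) (trans c≡2[1+p] (cong (2 ℕ.*_) (sym (trans (ℕₚ.+-identityʳ (toℕ half)) toℕ-half)))) ,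
     cong (_+ℤ 1ℤ) (trans (cong (-1ℤ ^_) c≡2[1+p]) (-1^[2*n] (suc p))))
    where
    c≡2[1+p] : c ≡ 2 ℕ.* suc p
    c≡2[1+p] = trans (cong suc m≡1+2p) (sym (ℕₚ.*-suc 2 p))
    p<m : suc p ℕ.< c
    p<m = ℕ.s≤s (subst (suc p ℕ.≤_) (sym m≡1+2p) (ℕ.s≤s (ℕₚ.m≤n*m p 2)))
    half : Fin c
    half = fromℕ< p<m
    toℕ-half : toℕ half ≡ suc p
    toℕ-half = toℕ-fromℕ< p<m
    half+half : toℕ half ℕ.+ toℕ half ≡ c
    half+half = trans (cong (λ x → x ℕ.+ x) toℕ-half) (trans (sym (2*n≡n+n (suc p))) (sym c≡2[1+p]))

  module _ .{{nz : NonZero c}} where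
    r≡ρ : ∀ n k → r (+ n -ℤ + k) c {{nz}} ≡ ρ n k
    r≡ρ n       zero    = trans (cong (λ x → r (+ x) c {{nz}}) (ℕₚ.+-identityʳ n)) (r≡length n c {{nz}} (involutions≡ n {{nz}}))
    r≡ρ zero    (suc k) = refl
    r≡ρ (suc n) (suc k) = trans (cong (λ z → r z c {{nz}}) (shift n k)) (r≡ρ n k)
      where
      shift : ∀ n k → + suc n -ℤ + suc k ≡ + n -ℤ + k
      shift n k = trans (ℤₚ.[1+m]⊖[1+n]≡m⊖n n k) (sym (ℤₚ.m-n≡m⊖n n k))

    iNum-formula : ∀ n → iNum n c {{nz}} ≡
      n ℕ.* h ℕ.* r (+ n -ℤ + 1) c {{nz}}
        ℕ.+ c ℕ.* (c ℕ.+ f ℕ.* g) ℕ.* (n C 2) ℕ.* r (+ n -ℤ + 2) c {{nz}}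
        ℕ.+ 2 ℕ.* c ℕ.* c ℕ.* (f ℕ.+ g) ℕ.* (n C 3) ℕ.* r (+ n -ℤ + 3) c {{nz}}
        ℕ.+ 6 ℕ.* c ℕ.* c ℕ.* c ℕ.* (n C 4) ℕ.* r (+ n -ℤ + 4) c {{nz}}
    iNum-formula n = trans (iNum≡Σ n c {{nz}} (involutions≡ n {{nz}})) (trans (totalInvc≡closedForm n) (trans
      (cong (λ x → h ℕ.* x ℕ.+ x₂ ℕ.* P 2 n ℕ.+ x₃ ℕ.* P 3 n ℕ.+ x₄ ℕ.* P 4 n) (P1 n))
      (reassociate h n x₂ (n C 2) x₃ (n C 3) x₄ (n C 4) (r≡ρ n 1) (r≡ρ n 2) (r≡ρ n 3) (r≡ρ n 4))))
      where
      x₂ x₃ x₄ : ℕ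
      x₂ = c ℕ.* (c ℕ.+ f ℕ.* g)
      x₃ = 2 ℕ.* c ℕ.* c ℕ.* (f ℕ.+ g)
      x₄ = 6 ℕ.* c ℕ.* c ℕ.* c
      reassociate : ∀ h n a b d e u v {r₁ r₂ r₃ r₄ s₁ s₂ s₃ s₄} → s₁ ≡ r₁ → s₂ ≡ r₂ → s₃ ≡ r₃ → s₄ ≡ r₄ →
        h ℕ.* (n ℕ.* r₁) ℕ.+ a ℕ.* (b ℕ.* r₂) ℕ.+ d ℕ.* (e ℕ.* r₃) ℕ.+ u ℕ.* (v ℕ.* r₄) ≡
        n ℕ.* h ℕ.* s₁ ℕ.+ a ℕ.* b ℕ.* s₂ ℕ.+ d ℕ.* e ℕ.* s₃ ℕ.+ u ℕ.* v ℕ.* s₄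
      reassociate h n a b d e u v {r₁} {r₂} {r₃} {r₄} refl refl refl refl = lem h n r₁ a b r₂ d e r₃ u v r₄
        where
        lem : ∀ h n r₁ a b r₂ d e r₃ u v r₄ →
          h ℕ.* (n ℕ.* r₁) ℕ.+ a ℕ.* (b ℕ.* r₂) ℕ.+ d ℕ.* (e ℕ.* r₃) ℕ.+ u ℕ.* (v ℕ.* r₄) ≡
          n ℕ.* h ℕ.* r₁ ℕ.+ a ℕ.* b ℕ.* r₂ ℕ.+ d ℕ.* e ℕ.* r₃ ℕ.+ u ℕ.* v ℕ.* r₄
        lem = solve-∀

-- Natural numbers inside the rationals.

toℚᵘ-/1 : ∀ a → toℚᵘ (a / 1) ℚᵘ.≃ ℚᵘ.mkℚᵘ a 0
toℚᵘ-/1 a = ℚₚ.toℚᵘ-fromℚᵘ (ℚᵘ.mkℚᵘ a 0)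

/1-homo-+ : ∀ a b → (a / 1) + (b / 1) ≡ (a +ℤ b) / 1
/1-homo-+ a b = ℚₚ.toℚᵘ-injective (begin
  toℚᵘ ((a / 1) + (b / 1))        ≈⟨ ℚₚ.toℚᵘ-homo-+ (a / 1) (b / 1) ⟩
  toℚᵘ (a / 1) ℚᵘ.+ toℚᵘ (b / 1)  ≈⟨ ℚᵘₚ.+-cong (toℚᵘ-/1 a) (toℚᵘ-/1 b) ⟩
  ℚᵘ.mkℚᵘ a 0 ℚᵘ.+ ℚᵘ.mkℚᵘ b 0    ≡⟨ cong (λ z → ℚᵘ.mkℚᵘ z 0) (cong₂ _+ℤ_ (ℤₚ.*-identityʳ a) (ℤₚ.*-identityʳ b)) ⟩
  ℚᵘ.mkℚᵘ (a +ℤ b) 0              ≈⟨ toℚᵘ-/1 (a +ℤ b) ⟨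
  toℚᵘ ((a +ℤ b) / 1)             ∎)
  where open ℚᵘₚ.≃-Reasoning

/1-homo-* : ∀ a b → (a / 1) * (b / 1) ≡ (a *ℤ b) / 1
/1-homo-* a b = ℚₚ.toℚᵘ-injective (begin
  toℚᵘ ((a / 1) * (b / 1))        ≈⟨ ℚₚ.toℚᵘ-homo-* (a / 1) (b / 1) ⟩
  toℚᵘ (a / 1) ℚᵘ.* toℚᵘ (b / 1)  ≈⟨ ℚᵘₚ.*-cong (toℚᵘ-/1 a) (toℚᵘ-/1 b) ⟩
  ℚᵘ.mkℚᵘ (a *ℤ b) 0              ≈⟨ toℚᵘ-/1 (a *ℤ b) ⟨
  toℚᵘ ((a *ℤ b) / 1)             ∎)
  where open ℚᵘₚ.≃-Reasoning

[k*4]/4 : ∀ k → (+ (k ℕ.* 4)) / 4 ≡ (+ k) / 1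
[k*4]/4 k = ℚₚ.fromℚᵘ-cong {ℚᵘ.mkℚᵘ (+ (k ℕ.* 4)) 3} {ℚᵘ.mkℚᵘ (+ k) 0}
  (ℚᵘ.*≡* (trans (ℤₚ.*-identityʳ _) (ℤₚ.pos-* k 4)))

/1-+-* : ∀ {q a} k s → q ≡ (+ a) / 1 → q + ((+ k) / 1) * ((+ s) / 1) ≡ (+ (a ℕ.+ k ℕ.* s)) / 1
/1-+-* {a = a} k s refl = trans
  (cong (λ x → (+ a) / 1 + x) (trans (/1-homo-* (+ k) (+ s)) (cong (_/ 1) (sym (ℤₚ.pos-* k s)))))
  (/1-homo-+ (+ a) (+ (k ℕ.* s)))

-- The `z` are the integer numerators of the coefficients. As the first is a multiple of 4, every
-- coefficient is a natural number and the rational identity reduces to one in `ℕ`.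
weightedSum-/1 : ∀ {k₁ k₂ k₃ k₄} I z₁ z₂ z₃ z₄ s₁ s₂ s₃ s₄ →
  I ≡ k₁ ℕ.* s₁ ℕ.+ k₂ ℕ.* s₂ ℕ.+ k₃ ℕ.* s₃ ℕ.+ k₄ ℕ.* s₄ →
  z₁ ≡ + (k₁ ℕ.* 4) → z₂ ≡ + k₂ → z₃ ≡ + k₃ → z₄ ≡ + k₄ →
  (+ I) / 1 ≡ (z₁ / 4) * ((+ s₁) / 1) + (z₂ / 1) * ((+ s₂) / 1) + (z₃ / 1) * ((+ s₃) / 1) + (z₄ / 1) * ((+ s₄) / 1)
weightedSum-/1 {k₁} {k₂} {k₃} {k₄} _ _ _ _ _ s₁ s₂ s₃ s₄ refl refl refl refl refl = sym
  (/1-+-* {q₃} {k₁ ℕ.* s₁ ℕ.+ k₂ ℕ.* s₂ ℕ.+ k₃ ℕ.* s₃} k₄ s₄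
    (/1-+-* {q₂} {k₁ ℕ.* s₁ ℕ.+ k₂ ℕ.* s₂} k₃ s₃
      (/1-+-* {q₁} {k₁ ℕ.* s₁} k₂ s₂ (trans (cong (_* ((+ s₁) / 1)) ([k*4]/4 k₁))
        (trans (/1-homo-* (+ k₁) (+ s₁)) (cong (_/ 1) (sym (ℤₚ.pos-* k₁ s₁))))))))
  where
  q₁ q₂ q₃ : ℚ
  q₁ = (+ (k₁ ℕ.* 4)) / 4 * ((+ s₁) / 1)
  q₂ = q₁ + ((+ k₂) / 1) * ((+ s₂) / 1)
  q₃ = q₂ + ((+ k₃) / 1) * ((+ s₃) / 1)

pos-*₃ : ∀ a b d → + a *ℤ + b *ℤ + d ≡ + (a ℕ.* b ℕ.* d)
pos-*₃ a b d = trans (cong (_*ℤ + d) (sym (ℤₚ.pos-* a b))) (sym (ℤₚ.pos-* (a ℕ.* b) d))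

pos-*₅ : ∀ a b d e u → + a *ℤ + b *ℤ + d *ℤ + e *ℤ + u ≡ + (a ℕ.* b ℕ.* d ℕ.* e ℕ.* u)
pos-*₅ a b d e u = trans (cong (λ z → z *ℤ + e *ℤ + u) (pos-*₃ a b d)) (pos-*₃ (a ℕ.* b ℕ.* d) e u)

-- The sign `ε`, the total `I` and the counts `s₁` to `s₄` are variables, so this step is pure
-- arithmetic and does not touch the enumeration of involutions.
closedForm-ℚ : ∀ n c {f g h} ε I s₁ s₂ s₃ s₄ →
  f ≡ suc g × f ℕ.* g ≡ 2 ℕ.* g × c ℕ.* g ≡ 2 ℕ.* h × ε +ℤ 1ℤ ≡ + (2 ℕ.* g) →
  I ≡ n ℕ.* h ℕ.* s₁ ℕ.+ c ℕ.* (c ℕ.+ f ℕ.* g) ℕ.* (n C 2) ℕ.* s₂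
    ℕ.+ 2 ℕ.* c ℕ.* c ℕ.* (f ℕ.+ g) ℕ.* (n C 3) ℕ.* s₃ ℕ.+ 6 ℕ.* c ℕ.* c ℕ.* c ℕ.* (n C 4) ℕ.* s₄ →
  (+ I) / 1
    ≡ ((+ n *ℤ + c *ℤ (ε +ℤ 1ℤ)) / 4) * ((+ s₁) / 1)
    + ((+ c *ℤ (+ c +ℤ 1ℤ +ℤ ε) *ℤ + (n C 2)) / 1) * ((+ s₂) / 1)
    + ((+ 2 *ℤ + c *ℤ + c *ℤ (ε +ℤ + 2) *ℤ + (n C 3)) / 1) * ((+ s₃) / 1)
    + ((+ 6 *ℤ + c *ℤ + c *ℤ + c *ℤ + (n C 4)) / 1) * ((+ s₄) / 1)
closedForm-ℚ n c {f} {g} {h} ε I s₁ s₂ s₃ s₄ (f≡1+g , fg≡2g , cg≡2h , ε+1≡2g) I≡ = weightedSum-/1 {n ℕ.* h} I _ _ _ _ s₁ s₂ s₃ s₄ I≡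
  -- The numerator is nc times 2g, and cg = 2h turns it into 4nh; this is the division by 4.
  (trans (cong (+ n *ℤ + c *ℤ_) ε+1≡2g) (trans (pos-*₃ n c (2 ℕ.* g)) (cong +_ nc[2g]≡nh4)))
  (trans (cong (λ z → + c *ℤ z *ℤ + (n C 2)) c+1+ε) (pos-*₃ c (c ℕ.+ f ℕ.* g) (n C 2)))
  (trans (cong (λ z → + 2 *ℤ + c *ℤ + c *ℤ z *ℤ + (n C 3)) ε+2) (pos-*₅ 2 c c (f ℕ.+ g) (n C 3)))
  (pos-*₅ 6 c c c (n C 4))
  where
  open ≡-Reasoning
  nc[2g]≡nh4 : n ℕ.* c ℕ.* (2 ℕ.* g) ≡ n ℕ.* h ℕ.* 4
  nc[2g]≡nh4 = begin
    n ℕ.* c ℕ.* (2 ℕ.* g)    ≡⟨ lem₁ n c g ⟩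
    n ℕ.* 2 ℕ.* (c ℕ.* g)    ≡⟨ cong (n ℕ.* 2 ℕ.*_) cg≡2h ⟩
    n ℕ.* 2 ℕ.* (2 ℕ.* h)    ≡⟨ lem₂ n h ⟩
    n ℕ.* h ℕ.* 4            ∎
    where
    lem₁ : ∀ n c g → n ℕ.* c ℕ.* (2 ℕ.* g) ≡ n ℕ.* 2 ℕ.* (c ℕ.* g)
    lem₁ = solve-∀
    lem₂ : ∀ n h → n ℕ.* 2 ℕ.* (2 ℕ.* h) ≡ n ℕ.* h ℕ.* 4
    lem₂ = solve-∀
  c+1+ε : + c +ℤ 1ℤ +ℤ ε ≡ + (c ℕ.+ f ℕ.* g)
  c+1+ε = begin
    + c +ℤ 1ℤ +ℤ ε         ≡⟨ ℤₚ.+-assoc (+ c) 1ℤ ε ⟩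
    + c +ℤ (1ℤ +ℤ ε)       ≡⟨ cong (+ c +ℤ_) (trans (ℤₚ.+-comm 1ℤ ε) ε+1≡2g) ⟩
    + (c ℕ.+ 2 ℕ.* g)      ≡⟨ cong (λ x → + (c ℕ.+ x)) fg≡2g ⟨
    + (c ℕ.+ f ℕ.* g)      ∎
  ε+2 : ε +ℤ + 2 ≡ + (f ℕ.+ g)
  ε+2 = begin
    ε +ℤ + 2               ≡⟨ ℤₚ.+-assoc ε 1ℤ 1ℤ ⟨
    ε +ℤ 1ℤ +ℤ 1ℤ          ≡⟨ cong (_+ℤ 1ℤ) ε+1≡2g ⟩
    + (2 ℕ.* g ℕ.+ 1)      ≡⟨ cong +_ (lem g) ⟩
    + (suc g ℕ.+ g)        ≡⟨ cong (λ x → + (x ℕ.+ g)) f≡1+g ⟨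
    + (f ℕ.+ g)            ∎
    where
    lem : ∀ g → 2 ℕ.* g ℕ.+ 1 ≡ suc g ℕ.+ g
    lem = solve-∀

theorem5p3 : (n c : ℕ) .{{_ : NonZero c}} →
    (+ iNum n c) / 1
    ≡ ((+ n *ℤ + c *ℤ (-1ℤ ^ c +ℤ 1ℤ)) / 4) * ((+ r (+ n -ℤ + 1) c) / 1)
    + ((+ c *ℤ (+ c +ℤ 1ℤ +ℤ -1ℤ ^ c) *ℤ + (n C 2)) / 1) * ((+ r (+ n -ℤ + 2) c) / 1)
    + ((+ 2 *ℤ + c *ℤ + c *ℤ (-1ℤ ^ c +ℤ + 2) *ℤ + (n C 3)) / 1) * ((+ r (+ n -ℤ + 3) c) / 1)
    + ((+ 6 *ℤ + c *ℤ + c *ℤ + c *ℤ + (n C 4)) / 1) * ((+ r (+ n -ℤ + 4) c) / 1)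
theorem5p3 n c@(suc m) {{nz}} = closedForm-ℚ n c (-1ℤ ^ c) (iNum n c {{nz}})
  (r (+ n -ℤ + 1) c {{nz}}) (r (+ n -ℤ + 2) c {{nz}}) (r (+ n -ℤ + 3) c {{nz}}) (r (+ n -ℤ + 4) c {{nz}})
  (colorRelations m) (iNum-formula m {{nz}} n)
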